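{- Let $G$ be a topological group, let $\mathfrak M$ be a $G$-Mackey system consisting of closed subgroups of $G$ such that $[H:I]<\infty$ whenever $H\in\mathfrak M_{\mathrm b}$ and $I\in\mathfrak M_{\mathrm r}(H)$ (i.e. $\mathfrak M\le\mathrm{Grp}(G)^{\mathrm{r\text{ - }f}}$), and let $\mathrm R$ be an abelianization system on $\mathfrak M$. Then $\pi_{\mathrm R}:\mathfrak M\to\mathsf{TAb}$ is a cohomological Mackey functor.
   Context: $\mathsf{TAb}$ is the category of topological abelian groups. ${}^gH=gHg^{ -1}$, $H^g=g^{ -1}Hg$. A $G$-Mackey system $\mathfrak M=(\mathfrak M_{\mathrm b},\mathfrak M_{\mathrm r},\mathfrak M_{\mathrm i})$ consists of a non-empty set $\mathfrak M_{\mathrm b}$ of subgroups of $G$ closed under conjugation and, for each $H\in\mathfrak M_{\mathrm b}$ and $\star\in\{\mathrm r,\mathrm i\}$, a set $\mathfrak M_\star(H)\subseteq\{I\in\mathfrak M_{\mathrm b}:I\le H\}$ with $H\in\mathfrak M_\star(H)$; $I\in\mathfrak M_\star(H)\Rightarrow\mathfrak M_\star(I)\subseteq\mathfrak M_\star(H)$; ${}^g\mathfrak M_\star(H)=\mathfrak M_\star({}^gH)$; and for $I\in\mathfrak M_{\mathrm r}(H)$, $J\in\mathfrak M_{\mathrm i}(H)$: $I\backslash H/J$ is finite, $I\cap J\in\mathfrak M_{\mathrm r}(J)$, $I\cap J\in\mathfrak M_{\mathrm i}(I)$. A Mackey functor $\Phi:\mathfrak M\to\mathsf{TAb}$ consists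 of objects $\Phi(H)$ ($H\in\mathfrak M_{\mathrm b}$) and morphisms $\mathrm{res}_{I,H}:\Phi(H)\to\Phi(I)$ ($I\in\mathfrak M_{\mathrm r}(H)$), $\mathrm{ind}_{H,I}:\Phi(I)\to\Phi(H)$ ($I\in\mathfrak M_{\mathrm i}(H)$), $\mathrm{con}_{g,H}:\Phi(H)\to\Phi({}^gH)$ with: $\mathrm{res}_{H,H}=\mathrm{ind}_{H,H}=\mathrm{id}$, $\mathrm{con}_{h,H}=\mathrm{id}$ for $h\in H$; $\mathrm{res}_{J,I}\mathrm{res}_{I,H}=\mathrm{res}_{J,H}$, $\mathrm{ind}_{H,I}\mathrm{ind}_{I,J}=\mathrm{ind}_{H,J}$, $\mathrm{con}_{g',{}^gH}\mathrm{con}_{g,H}=\mathrm{con}_{g'g,H}$; $\mathrm{con}_{g,I}\mathrm{res}_{I,H}=\mathrm{res}_{{}^gI,{}^gH}\mathrm{con}_{g,H}$, $\mathrm{con}_{g,H}\mathrm{ind}_{H,I}=\mathrm{ind}_{{}^gH,{}^gI}\mathrm{con}_{g,I}$; and the Mackey formula $\mathrm{res}_{I,H}\mathrm{ind}_{H,J}=\sum_{h}\mathrm{ind}_{I,I\cap{}^hJ}\,\mathrm{con}_{h,I^h\cap J}\,\mathrm{res}_{I^h\cap J,J}$ ($h$ over representatives of $I\backslash H/J$). It is cohomological if $\mathrm{ind}_{H,I}\mathrm{res}_{I,H}=[H:I]\cdot\mathrm{id}$ for $I\in\mathfrak M_{\mathrm r}(H)\cap\mathfrak M_{\mathrm i}(H)$.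 Transfer. For $I\le H$ closed of finite index with right transversal $T=(t_1,\dots,t_n)$ write $t_ih=\kappa_T(t_ih)t_{\sigma(i)}$ with $\kappa_T(t_ih)\in I$ and $\sigma$ a permutation. For $N\lhd I$ with $I/N$ abelian, $\mathrm V^N_{I,H}:H\to I/N$, $h\mapsto\prod_i\kappa_T(t_ih)\bmod N$, is a continuous homomorphism independent of $T$. An abelianization system on $\mathfrak M$ is a family $\mathrm R=\{\mathrm R(H):H\in\mathfrak M_{\mathrm b}\}$ of closed normal subgroups $\mathrm R(H)\lhd H$ with $H/\mathrm R(H)$ abelian, $\mathrm R({}^gH)={}^g\mathrm R(H)$, $\mathrm R(H)\subseteq\ker\mathrm V^{\mathrm R(I)}_{I,H}$ for $I\in\mathfrak M_{\mathrm r}(H)$, and $\mathrm R(I)\subseteq\mathrm R(H)$ for $I\in\mathfrak M_{\mathrm i}(H)$. Then $\pi_{\mathrm R}(H)=H/\mathrm R(H)$, with $\mathrm{con}_{g,H}$ induced by $h\mapsto ghg^{ -1}$, $\mathrm{res}_{I,H}:H/\mathrm R(H)\to I/\mathrm R(I)$ induced by $\mathrm V^{\mathrm R(I)}_{I,H}$, and $\mathrm{ind}_{H,I}:I/\mathrm R(I)\to H/\mathrm R(H)$ induced by the inclusion. -}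

module Defs where

open import Algebra.Bundles using (Group)
open import Algebra.Bundles.Raw using (RawGroup)
open import Algebra.Definitions using (Commutative)
open import Algebra.Definitions.RawMonoid using (sum) renaming (_×_ to _times_)
open import Algebra.Morphism.Structures using (module GroupMorphisms)
import Algebra.Properties.Group as GroupProperties
open import Algebra.Structures using (IsGroup)
open import Data.Fin.Base using (Fin)
open import Data.Nat.Base using (ℕ)
open import Data.Product.Base using (Σ; Σ-syntax; ∃; _×_; _,_; proj₁; proj₂; uncurry)
open import Data.Unit.Polymorphic.Base using (⊤)
open import Function.Base using (_∘_)
open import Level using (Level; _⊔_; suc)
open import Relation.Binary.Core using (Rel)
open import Relation.Binary.Definitions using (_Respects_)
open import Relation.Binary.PropositionalEquality.Core using (_≡_)
open import Relation.Binary.Structures using (IsEquivalence)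
open import Relation.Unary using (Pred; _∈_; _⊆_; _≐_; _∩_; ∁; ⋃)

-- A space is a setoid with a topology. Points and subsets live at level ℓ;
-- being open lives one level up, so that the subspace topology, which
-- quantifies over subsets of the ambient space, is again of this kind.
record RawSpace (ℓ : Level) : Set (suc (suc ℓ)) where
  field
    Carrier : Set ℓ
    _≈_     : Rel Carrier ℓ
    IsOpen  : Pred Carrier ℓ → Set (suc ℓ)

module _ {ℓ : Level} where

  record IsTopology (X : RawSpace ℓ) : Set (suc ℓ) where
    open RawSpace X
    field
      isEquivalence : IsEquivalence _≈_
      open-resp-≈   : ∀ {U} → IsOpen U → U Respects _≈_
      open-resp-≐   : ∀ {U V} → U ≐ V → IsOpen U → IsOpen V
      open-whole    : IsOpen (λ _ → ⊤)
      open-∩        : ∀ {U V} → IsOpen U → IsOpen V → IsOpen (U ∩ V)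
      open-⋃        : ∀ {A : Set ℓ} {U : A → Pred Carrier ℓ} →
                      (∀ a → IsOpen (U a)) → IsOpen (⋃ A U)

  IsClosed : (X : RawSpace ℓ) → Pred (RawSpace.Carrier X) ℓ → Set (suc ℓ)
  IsClosed X C = RawSpace.IsOpen X (∁ C)

  Continuous : (X Y : RawSpace ℓ) →
               (RawSpace.Carrier X → RawSpace.Carrier Y) → Set (suc ℓ)
  Continuous X Y f = ∀ {U} → RawSpace.IsOpen Y U → RawSpace.IsOpen X (U ∘ f)

  productSpace : RawSpace ℓ → RawSpace ℓ → RawSpace ℓ
  productSpace X Y = record
    { Carrier = X.Carrier × Y.Carrier
    ; _≈_     = λ p q → (proj₁ p X.≈ proj₁ q) × (proj₂ p Y.≈ proj₂ q)
    ; IsOpen  = λ U → ∀ {x y} → (x , y) ∈ U →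
        Σ[ V ∈ Pred X.Carrier ℓ ] Σ[ W ∈ Pred Y.Carrier ℓ ]
          X.IsOpen V × Y.IsOpen W × x ∈ V × y ∈ W ×
          (∀ {a b} → a ∈ V → b ∈ W → (a , b) ∈ U)
    }
    where
      module X = RawSpace X
      module Y = RawSpace Y

record RawTopologicalGroup (ℓ : Level) : Set (suc (suc ℓ)) where
  field
    rawGroup : RawGroup ℓ ℓ
  open RawGroup rawGroup public
  field
    IsOpen   : Pred Carrier ℓ → Set (suc ℓ)

  rawSpace : RawSpace ℓ
  rawSpace = record { Carrier = Carrier ; _≈_ = _≈_ ; IsOpen = IsOpen }

module _ {ℓ : Level} where

  record IsTopologicalGroup (A : RawTopologicalGroup ℓ) : Set (suc ℓ) where
    open RawTopologicalGroup A
    field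
      isGroup       : IsGroup _≈_ _∙_ ε _⁻¹
      isTopology    : IsTopology rawSpace
      ∙-continuous  : Continuous (productSpace rawSpace rawSpace) rawSpace (uncurry _∙_)
      ⁻¹-continuous : Continuous rawSpace rawSpace _⁻¹

  -- The objects of TAb; no separation axiom is imposed.
  record IsTopologicalAbelianGroup (A : RawTopologicalGroup ℓ) : Set (suc ℓ) where
    open RawTopologicalGroup A
    field
      isTopologicalGroup : IsTopologicalGroup A
      comm               : Commutative _≈_ _∙_

  record IsContinuousHomomorphism (A B : RawTopologicalGroup ℓ)
    (f : RawTopologicalGroup.Carrier A → RawTopologicalGroup.Carrier B) : Set (suc ℓ) where
    private
      module A = RawTopologicalGroup A
      module B = RawTopologicalGroup B
    field
      isGroupHomomorphism :
        GroupMorphisms.IsGroupHomomorphism A.rawGroup B.rawGroup f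
      continuous          : Continuous A.rawSpace B.rawSpace f

record TopologicalGroup (ℓ : Level) : Set (suc (suc ℓ)) where
  field
    rawTopologicalGroup : RawTopologicalGroup ℓ
    isTopologicalGroup  : IsTopologicalGroup rawTopologicalGroup
  open RawTopologicalGroup rawTopologicalGroup public
  open IsTopologicalGroup isTopologicalGroup public

  group : Group ℓ ℓ
  group = record { isGroup = isGroup }

record Subgroup {ℓ : Level} (G : TopologicalGroup ℓ) : Set (suc ℓ) where
  open TopologicalGroup G
  field
    mem       : Pred Carrier ℓ
    resp      : mem Respects _≈_
    ∙-closed  : ∀ {x y} → x ∈ mem → y ∈ mem → (x ∙ y) ∈ mem
    ε-closed  : ε ∈ mem
    ⁻¹-closed : ∀ {x} → x ∈ mem → (x ⁻¹) ∈ mem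

open Subgroup using (mem)

module _ {ℓ : Level} {G : TopologicalGroup ℓ} where

  open TopologicalGroup G
  open Group group using (setoid; refl; sym; trans; assoc; identityˡ; identityʳ;
                          inverseˡ; inverseʳ; ∙-cong; ∙-congˡ; ∙-congʳ; ⁻¹-cong)
  open GroupProperties group using (⁻¹-involutive; ⁻¹-anti-homo-∙)
  open import Relation.Binary.Reasoning.Setoid setoid

  infix 4 _≤_ _≋_

  _≤_ : Subgroup G → Subgroup G → Set ℓ
  I ≤ H = mem I ⊆ mem H

  record _≋_ (H K : Subgroup G) : Set ℓ where
    constructor mk≋
    field
      to   : H ≤ K
      from : K ≤ H

  open _≋_ public

  infixl 6 _⊓_

  _⊓_ : Subgroup G → Subgroup G → Subgroup G
  I ⊓ J = record
    { mem       = mem I ∩ mem J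
    ; resp      = λ e (p , q) → I.resp e p , J.resp e q
    ; ∙-closed  = λ (p , q) (p′ , q′) → I.∙-closed p p′ , J.∙-closed q q′
    ; ε-closed  = I.ε-closed , J.ε-closed
    ; ⁻¹-closed = λ (p , q) → I.⁻¹-closed p , J.⁻¹-closed q
    }
    where
      module I = Subgroup I
      module J = Subgroup J

  private
    cancelˡ : ∀ g x → g ⁻¹ ∙ (g ∙ x) ≈ x
    cancelˡ g x = begin
      g ⁻¹ ∙ (g ∙ x)  ≈⟨ assoc _ _ _ ⟨
      g ⁻¹ ∙ g ∙ x    ≈⟨ ∙-congʳ (inverseˡ g) ⟩
      ε ∙ x           ≈⟨ identityˡ x ⟩
      x               ∎

    cancelˡ′ : ∀ g x → g ∙ (g ⁻¹ ∙ x) ≈ x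
    cancelˡ′ g x = begin
      g ∙ (g ⁻¹ ∙ x)  ≈⟨ assoc _ _ _ ⟨
      g ∙ g ⁻¹ ∙ x    ≈⟨ ∙-congʳ (inverseʳ g) ⟩
      ε ∙ x           ≈⟨ identityˡ x ⟩
      x               ∎

    cancelʳ : ∀ x g → x ∙ g ⁻¹ ∙ g ≈ x
    cancelʳ x g = begin
      x ∙ g ⁻¹ ∙ g    ≈⟨ assoc _ _ _ ⟩
      x ∙ (g ⁻¹ ∙ g)  ≈⟨ ∙-congˡ (inverseˡ g) ⟩
      x ∙ ε           ≈⟨ identityʳ x ⟩
      x               ∎

    conj-product : ∀ g x y → (g ∙ x ∙ g ⁻¹) ∙ (g ∙ y ∙ g ⁻¹) ≈ g ∙ (x ∙ y) ∙ g ⁻¹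
    conj-product g x y = begin
      (g ∙ x ∙ g ⁻¹) ∙ (g ∙ y ∙ g ⁻¹)  ≈⟨ assoc _ _ _ ⟨
      (g ∙ x ∙ g ⁻¹) ∙ (g ∙ y) ∙ g ⁻¹  ≈⟨ ∙-congʳ (assoc _ _ _) ⟩
      g ∙ x ∙ (g ⁻¹ ∙ (g ∙ y)) ∙ g ⁻¹  ≈⟨ ∙-congʳ (∙-congˡ (cancelˡ g y)) ⟩
      g ∙ x ∙ y ∙ g ⁻¹                 ≈⟨ ∙-congʳ (assoc _ _ _) ⟩
      g ∙ (x ∙ y) ∙ g ⁻¹               ∎

    conj-inverse : ∀ g x → (g ∙ x ∙ g ⁻¹) ⁻¹ ≈ g ∙ x ⁻¹ ∙ g ⁻¹
    conj-inverse g x = begin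
      (g ∙ x ∙ g ⁻¹) ⁻¹         ≈⟨ ⁻¹-anti-homo-∙ _ _ ⟩
      (g ⁻¹) ⁻¹ ∙ (g ∙ x) ⁻¹    ≈⟨ ∙-cong (⁻¹-involutive g) (⁻¹-anti-homo-∙ g x) ⟩
      g ∙ (x ⁻¹ ∙ g ⁻¹)         ≈⟨ assoc _ _ _ ⟨
      g ∙ x ⁻¹ ∙ g ⁻¹           ∎

    conj-conj : ∀ g′ g x → g′ ∙ (g ∙ x ∙ g ⁻¹) ∙ g′ ⁻¹ ≈ (g′ ∙ g) ∙ x ∙ (g′ ∙ g) ⁻¹
    conj-conj g′ g x = begin
      g′ ∙ (g ∙ x ∙ g ⁻¹) ∙ g′ ⁻¹    ≈⟨ ∙-congʳ (assoc _ _ _) ⟨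
      g′ ∙ (g ∙ x) ∙ g ⁻¹ ∙ g′ ⁻¹    ≈⟨ ∙-congʳ (∙-congʳ (assoc _ _ _)) ⟨
      g′ ∙ g ∙ x ∙ g ⁻¹ ∙ g′ ⁻¹      ≈⟨ assoc _ _ _ ⟩
      g′ ∙ g ∙ x ∙ (g ⁻¹ ∙ g′ ⁻¹)    ≈⟨ ∙-congˡ (⁻¹-anti-homo-∙ g′ g) ⟨
      (g′ ∙ g) ∙ x ∙ (g′ ∙ g) ⁻¹     ∎

    conj-undo : ∀ g x → g ∙ (g ⁻¹ ∙ x ∙ (g ⁻¹) ⁻¹) ∙ g ⁻¹ ≈ x
    conj-undo g x = begin
      g ∙ (g ⁻¹ ∙ x ∙ (g ⁻¹) ⁻¹) ∙ g ⁻¹  ≈⟨ ∙-congʳ (∙-congˡ (assoc _ _ _)) ⟩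
      g ∙ (g ⁻¹ ∙ (x ∙ (g ⁻¹) ⁻¹)) ∙ g ⁻¹ ≈⟨ ∙-congʳ (cancelˡ′ g _) ⟩
      x ∙ (g ⁻¹) ⁻¹ ∙ g ⁻¹               ≈⟨ cancelʳ x (g ⁻¹) ⟩
      x                                  ∎

    conj-undo′ : ∀ g x → g ⁻¹ ∙ (g ∙ x ∙ g ⁻¹) ∙ (g ⁻¹) ⁻¹ ≈ x
    conj-undo′ g x = begin
      g ⁻¹ ∙ (g ∙ x ∙ g ⁻¹) ∙ (g ⁻¹) ⁻¹  ≈⟨ ∙-congˡ (⁻¹-involutive g) ⟩
      g ⁻¹ ∙ (g ∙ x ∙ g ⁻¹) ∙ g          ≈⟨ ∙-congʳ (∙-congˡ (assoc _ _ _)) ⟩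
      g ⁻¹ ∙ (g ∙ (x ∙ g ⁻¹)) ∙ g        ≈⟨ ∙-congʳ (cancelˡ g _) ⟩
      x ∙ g ⁻¹ ∙ g                       ≈⟨ cancelʳ x g ⟩
      x                                  ∎

    conj-resp : ∀ {g g′ x x′} → g ≈ g′ → x ≈ x′ → g ∙ x ∙ g ⁻¹ ≈ g′ ∙ x′ ∙ g′ ⁻¹
    conj-resp e f = ∙-cong (∙-cong e f) (⁻¹-cong e)

  -- ᵍH = g H g⁻¹
  conj : Carrier → Subgroup G → Subgroup G
  conj g H = record
    { mem       = λ x → ∃ λ y → y ∈ mem H × x ≈ g ∙ y ∙ g ⁻¹
    ; resp      = λ e (y , y∈H , p) → y , y∈H , trans (sym e) p
    ; ∙-closed  = λ (y , y∈H , p) (z , z∈H , q) →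
        y ∙ z , H.∙-closed y∈H z∈H , trans (∙-cong p q) (conj-product g y z)
    ; ε-closed  =
        ε , H.ε-closed , sym (trans (∙-congʳ (identityʳ g)) (inverseʳ g))
    ; ⁻¹-closed = λ (y , y∈H , p) →
        y ⁻¹ , H.⁻¹-closed y∈H , trans (⁻¹-cong p) (conj-inverse g y)
    }
    where module H = Subgroup H

  -- Hᵍ = g⁻¹ H g
  conj⁻ : Carrier → Subgroup G → Subgroup G
  conj⁻ g H = conj (g ⁻¹) H

  ≋-refl : ∀ {H} → H ≋ H
  ≋-refl = mk≋ (λ p → p) (λ p → p)

  ≋-sym : ∀ {H K} → H ≋ K → K ≋ H
  ≋-sym (mk≋ p q) = mk≋ q p

  ≋-trans : ∀ {H K L} → H ≋ K → K ≋ L → H ≋ L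
  ≋-trans p q = mk≋ (λ x → to q (to p x)) (λ x → from p (from q x))

  conj-cong : ∀ {g g′ H H′} → g ≈ g′ → H ≋ H′ → conj g H ≋ conj g′ H′
  conj-cong e p = mk≋
    (λ (y , y∈H , q) → y , to p y∈H , trans q (conj-resp e refl))
    (λ (y , y∈H , q) → y , from p y∈H , trans q (conj-resp (sym e) refl))

  conj-self : ∀ {H h} → h ∈ mem H → conj h H ≋ H
  conj-self {H} {h} h∈H = mk≋
    (λ (y , y∈H , q) →
      H.resp (sym q) (H.∙-closed (H.∙-closed h∈H y∈H) (H.⁻¹-closed h∈H)))
    (λ {x} x∈H → h ⁻¹ ∙ x ∙ (h ⁻¹) ⁻¹ ,
      H.∙-closed (H.∙-closed (H.⁻¹-closed h∈H) x∈H) (H.⁻¹-closed (H.⁻¹-closed h∈H)) ,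
      sym (conj-undo h x))
    where module H = Subgroup H

  conj-∙ : ∀ {g′ g H} → conj g′ (conj g H) ≋ conj (g′ ∙ g) H
  conj-∙ {g′} {g} = mk≋
    (λ (y , (z , z∈H , p) , q) →
      z , z∈H , trans q (trans (conj-resp refl p) (conj-conj g′ g z)))
    (λ (z , z∈H , q) →
      g ∙ z ∙ g ⁻¹ , (z , z∈H , refl) , trans q (sym (conj-conj g′ g z)))

  -- ʰ(Iʰ ∩ J) = I ∩ ʰJ
  conj-⊓ : ∀ {h I J} → conj h (conj⁻ h I ⊓ J) ≋ I ⊓ conj h J
  conj-⊓ {h} {I} {J} = mk≋
    (λ (y , ((z , z∈I , p) , y∈J) , q) →
      Subgroup.resp I (sym (trans q (trans (conj-resp refl p) (conj-undo h z)))) z∈I ,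
      (y , y∈J , q))
    (λ {x} (x∈I , (y , y∈J , q)) →
      y ,
      ((x , x∈I , trans (sym (conj-undo′ h y)) (conj-resp refl (sym q))) , y∈J) ,
      q)

  -- H = I t₁ ⊔ … ⊔ I tₙ
  record RightTransversal (H I : Subgroup G) : Set ℓ where
    field
      n      : ℕ
      t      : Fin n → Carrier
      t∈H    : ∀ k → t k ∈ mem H
      cover  : ∀ {h} → h ∈ mem H → Σ[ k ∈ Fin n ] (h ∙ t k ⁻¹) ∈ mem I
      unique : ∀ {h k l} → h ∈ mem H →
               (h ∙ t k ⁻¹) ∈ mem I → (h ∙ t l ⁻¹) ∈ mem I → k ≡ l

    -- x = κ x ∙ t k for the unique k with x ∈ I t k
    κ : ∀ {x} → x ∈ mem H → Σ Carrier (mem I)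
    κ {x} x∈H = x ∙ t (proj₁ (cover x∈H)) ⁻¹ , proj₂ (cover x∈H)

  -- H = I r₁ J ⊔ … ⊔ I rₙ J; as with RightTransversal, finiteness is given
  -- by an explicit enumeration of representatives.
  record DoubleCosetReps (I H J : Subgroup G) : Set ℓ where
    InDoubleCoset : Carrier → Pred Carrier ℓ
    InDoubleCoset r h =
      Σ[ a ∈ Carrier ] Σ[ b ∈ Carrier ] a ∈ mem I × b ∈ mem J × h ≈ a ∙ r ∙ b
    field
      n      : ℕ
      rep    : Fin n → Carrier
      rep∈H  : ∀ k → rep k ∈ mem H
      cover  : ∀ {h} → h ∈ mem H → Σ[ k ∈ Fin n ] InDoubleCoset (rep k) h
      unique : ∀ {h k l} → h ∈ mem H →
               InDoubleCoset (rep k) h → InDoubleCoset (rep l) h → k ≡ l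

  subgroupRaw : Subgroup G → RawTopologicalGroup ℓ
  subgroupRaw H = record
    { rawGroup = record
      { Carrier = Σ Carrier (mem H)
      ; _≈_     = λ x y → proj₁ x ≈ proj₁ y
      ; _∙_     = λ (x , p) (y , q) → x ∙ y , H.∙-closed p q
      ; ε       = ε , H.ε-closed
      ; _⁻¹     = λ (x , p) → x ⁻¹ , H.⁻¹-closed p
      }
    ; IsOpen   = λ U → Σ[ W ∈ Pred Carrier ℓ ] IsOpen W × U ≐ (W ∘ proj₁)
    }
    where module H = Subgroup H

  -- H/N: the carrier is that of H, only the equality changes, so a subset
  -- of H/N is a subset of H that respects congruence modulo N.
  quotientRaw : Subgroup G → Subgroup G → RawTopologicalGroup ℓ
  quotientRaw H N = record
    { rawGroup = record
      { Carrier = H.Carrier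
      ; _≈_     = _≈N_
      ; _∙_     = H._∙_
      ; ε       = H.ε
      ; _⁻¹     = H._⁻¹
      }
    ; IsOpen   = λ U → U Respects _≈N_ × H.IsOpen U
    }
    where
      module H = RawTopologicalGroup (subgroupRaw H)
      _≈N_ : Rel H.Carrier ℓ
      x ≈N y = proj₁ (x H.∙ y H.⁻¹) ∈ mem N

  -- ∏ₖ κ(tₖ h) mod N, the product being taken in I/N.
  transfer : {H I : Subgroup G} → RightTransversal H I → (N : Subgroup G) →
             Σ Carrier (mem H) → RawTopologicalGroup.Carrier (quotientRaw I N)
  transfer {H} {I} T N (h , h∈H) =
    sum (RawTopologicalGroup.rawMonoid (quotientRaw I N))
        (λ k → κ (Subgroup.∙-closed H (t∈H k) h∈H))
    where open RightTransversal T

data Kind : Set where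
  r i : Kind

record MackeySystem {ℓ : Level} (G : TopologicalGroup ℓ) (m : Level) :
                    Set (suc (ℓ ⊔ m)) where
  open TopologicalGroup G using (Carrier)
  field
    𝔐b       : Pred (Subgroup G) m
    𝔐b-resp  : ∀ {H K} → H ≋ K → 𝔐b H → 𝔐b K
    nonempty : ∃ 𝔐b
    𝔐b-conj  : ∀ g {H} → 𝔐b H → 𝔐b (conj g H)

  Obj : Set (suc ℓ ⊔ m)
  Obj = Σ (Subgroup G) 𝔐b

  ⌊_⌋ : Obj → Subgroup G
  ⌊_⌋ = proj₁

  infixr 7 _·_

  _·_ : Carrier → Obj → Obj
  g · (H , b) = conj g H , 𝔐b-conj g b

  -- 𝔐 ⋆ H I encodes I ∈ 𝔐⋆(H).
  field
    𝔐        : Kind → Obj → Obj → Set m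
    𝔐-resp   : ∀ {⋆ H H′ I I′} → ⌊ H ⌋ ≋ ⌊ H′ ⌋ → ⌊ I ⌋ ≋ ⌊ I′ ⌋ →
               𝔐 ⋆ H I → 𝔐 ⋆ H′ I′
    𝔐-sub    : ∀ {⋆ H I} → 𝔐 ⋆ H I → ⌊ I ⌋ ≤ ⌊ H ⌋
    𝔐-refl   : ∀ {⋆} H → 𝔐 ⋆ H H
    𝔐-trans  : ∀ {⋆ H I J} → 𝔐 ⋆ H I → 𝔐 ⋆ I J → 𝔐 ⋆ H J
    𝔐-conj   : ∀ {⋆} g {H I} → 𝔐 ⋆ H I → 𝔐 ⋆ (g · H) (g · I)
    𝔐-conj⁻  : ∀ {⋆} g {H K} → 𝔐 ⋆ (g · H) K →
               Σ[ I ∈ Obj ] 𝔐 ⋆ H I × ⌊ K ⌋ ≋ ⌊ g · I ⌋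
    finite   : ∀ {H I J} → 𝔐 r H I → 𝔐 i H J → DoubleCosetReps ⌊ I ⌋ ⌊ H ⌋ ⌊ J ⌋
    ⊓-b      : ∀ {H I J} → 𝔐 r H I → 𝔐 i H J → 𝔐b (⌊ I ⌋ ⊓ ⌊ J ⌋)
    ⊓-r      : ∀ {H I J} (p : 𝔐 r H I) (q : 𝔐 i H J) → 𝔐 r J (⌊ I ⌋ ⊓ ⌊ J ⌋ , ⊓-b p q)
    ⊓-i      : ∀ {H I J} (p : 𝔐 r H I) (q : 𝔐 i H J) → 𝔐 i I (⌊ I ⌋ ⊓ ⌊ J ⌋ , ⊓-b p q)

  open TopologicalGroup G using (_⁻¹)

  𝔐-conj-self : ∀ {⋆ H I h} → h ∈ mem ⌊ H ⌋ → 𝔐 ⋆ H I → 𝔐 ⋆ H (h · I)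
  𝔐-conj-self {h = h} h∈H p = 𝔐-resp (conj-self h∈H) ≋-refl (𝔐-conj h p)

  module DoubleCoset {H I J h} (p : 𝔐 r H I) (q : 𝔐 i H J) (h∈H : h ∈ mem ⌊ H ⌋) where

    private
      p′ : 𝔐 r H (h ⁻¹ · I)
      p′ = 𝔐-conj-self (Subgroup.⁻¹-closed ⌊ H ⌋ h∈H) p

      q′ : 𝔐 i H (h · J)
      q′ = 𝔐-conj-self h∈H q

    Iʰ∩J : Obj
    Iʰ∩J = conj⁻ h ⌊ I ⌋ ⊓ ⌊ J ⌋ , ⊓-b p′ q

    I∩ʰJ : Obj
    I∩ʰJ = ⌊ I ⌋ ⊓ conj h ⌊ J ⌋ , ⊓-b p q′

    Iʰ∩J∈𝔐r : 𝔐 r J Iʰ∩J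
    Iʰ∩J∈𝔐r = ⊓-r p′ q

    I∩ʰJ∈𝔐i : 𝔐 i I I∩ʰJ
    I∩ʰJ∈𝔐i = ⊓-i p q′

-- 𝔐 ≤ Grp(G)^{r-f}
record IsRFinite {ℓ m : Level} {G : TopologicalGroup ℓ} (M : MackeySystem G m) :
                 Set (suc ℓ ⊔ m) where
  open MackeySystem M
  field
    closed      : ∀ (H : Obj) → IsClosed (TopologicalGroup.rawSpace G) (mem ⌊ H ⌋)
    transversal : ∀ {H I} → 𝔐 r H I → RightTransversal ⌊ H ⌋ ⌊ I ⌋

  index : ∀ {H I} → 𝔐 r H I → ℕ
  index p = RightTransversal.n (transversal p)

module _ {ℓ m : Level} {G : TopologicalGroup ℓ} (M : MackeySystem G m) where

  open TopologicalGroup G using (Carrier; _∙_) renaming (_≈_ to _≈G_)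
  open MackeySystem M

  -- Subgroups are compared by _≋_, so a family indexed by 𝔐b comes with
  -- the identifications Φ(H) = Φ(K) for H ≋ K.
  record RawMackeyFunctor (v : Level) : Set (suc (ℓ ⊔ m ⊔ suc v)) where
    field
      obj : Obj → RawTopologicalGroup v

    ∣_∣ : Obj → Set v
    ∣ H ∣ = RawTopologicalGroup.Carrier (obj H)

    field
      cast : ∀ {H K} → ⌊ H ⌋ ≋ ⌊ K ⌋ → ∣ H ∣ → ∣ K ∣
      res  : ∀ {H I} → 𝔐 r H I → ∣ H ∣ → ∣ I ∣
      ind  : ∀ {H I} → 𝔐 i H I → ∣ I ∣ → ∣ H ∣
      con  : ∀ g H → ∣ H ∣ → ∣ g · H ∣

    Eq : (H : Obj) → Rel ∣ H ∣ v
    Eq H = RawTopologicalGroup._≈_ (obj H)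

    syntax Eq H x y = x ≈[ H ] y

  record IsMackeyFunctor {v : Level} (Φ : RawMackeyFunctor v) :
                         Set (suc (ℓ ⊔ v) ⊔ m) where
    open RawMackeyFunctor Φ
    field
      obj-TAb : ∀ H → IsTopologicalAbelianGroup (obj H)
      cast-TAb : ∀ {H K} (e : ⌊ H ⌋ ≋ ⌊ K ⌋) →
                 IsContinuousHomomorphism (obj H) (obj K) (cast e)
      res-TAb : ∀ {H I} (p : 𝔐 r H I) →
                IsContinuousHomomorphism (obj H) (obj I) (res p)
      ind-TAb : ∀ {H I} (q : 𝔐 i H I) →
                IsContinuousHomomorphism (obj I) (obj H) (ind q)
      con-TAb : ∀ g H → IsContinuousHomomorphism (obj H) (obj (g · H)) (con g H)

      -- Φ, res, ind and con depend only on the subgroups (and group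
      -- element) named, not on the chosen presentation of them or on the
      -- membership proofs.
      cast-id    : ∀ {H} (e : ⌊ H ⌋ ≋ ⌊ H ⌋) x → cast e x ≈[ H ] x
      cast-trans : ∀ {H K L} (e : ⌊ H ⌋ ≋ ⌊ K ⌋) (f : ⌊ K ⌋ ≋ ⌊ L ⌋) (x : ∣ H ∣) →
                   cast {K} {L} f (cast e x) ≈[ L ] cast (≋-trans e f) x
      cast-res   : ∀ {H H′ I I′} (e : ⌊ H ⌋ ≋ ⌊ H′ ⌋) (f : ⌊ I ⌋ ≋ ⌊ I′ ⌋)
                   (p : 𝔐 r H I) (p′ : 𝔐 r H′ I′) x →
                   cast f (res p x) ≈[ I′ ] res p′ (cast e x)
      cast-ind   : ∀ {H H′ I I′} (e : ⌊ H ⌋ ≋ ⌊ H′ ⌋) (f : ⌊ I ⌋ ≋ ⌊ I′ ⌋)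
                   (q : 𝔐 i H I) (q′ : 𝔐 i H′ I′) x →
                   cast e (ind q x) ≈[ H′ ] ind q′ (cast f x)
      cast-con   : ∀ {g g′ H H′} (d : g ≈G g′) (e : ⌊ H ⌋ ≋ ⌊ H′ ⌋) x →
                   cast (conj-cong d e) (con g H x) ≈[ g′ · H′ ] con g′ H′ (cast e x)

      res-id : ∀ {H} (p : 𝔐 r H H) x → res p x ≈[ H ] x
      ind-id : ∀ {H} (q : 𝔐 i H H) x → ind q x ≈[ H ] x
      con-id : ∀ {H h} (h∈H : h ∈ mem ⌊ H ⌋) x → cast (conj-self h∈H) (con h H x) ≈[ H ] x

      res-res : ∀ {H I J} (p : 𝔐 r H I) (p′ : 𝔐 r I J) x →
                res p′ (res p x) ≈[ J ] res (𝔐-trans p p′) x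
      ind-ind : ∀ {H I J} (q : 𝔐 i H I) (q′ : 𝔐 i I J) x →
                ind q (ind q′ x) ≈[ H ] ind (𝔐-trans q q′) x
      con-con : ∀ {g′ g H} x →
                cast (conj-∙ {H = ⌊ H ⌋}) (con g′ (g · H) (con g H x))
                ≈[ (g′ ∙ g) · H ] con (g′ ∙ g) H x

      con-res : ∀ {g H I} (p : 𝔐 r H I) x →
                con g I (res p x) ≈[ g · I ] res (𝔐-conj g p) (con g H x)
      con-ind : ∀ {g H I} (q : 𝔐 i H I) x →
                con g H (ind q x) ≈[ g · H ] ind (𝔐-conj g q) (con g I x)

      mackey : ∀ {H I J} (p : 𝔐 r H I) (q : 𝔐 i H J)
               (D : DoubleCosetReps ⌊ I ⌋ ⌊ H ⌋ ⌊ J ⌋) x →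
               let open DoubleCosetReps D using (rep; rep∈H) in
               res p (ind q x) ≈[ I ]
               sum (RawTopologicalGroup.rawMonoid (obj I)) (λ k →
                 let open DoubleCoset p q (rep∈H k) in
                 ind I∩ʰJ∈𝔐i (cast (conj-⊓ {I = ⌊ I ⌋} {⌊ J ⌋})
                   (con (rep k) Iʰ∩J (res Iʰ∩J∈𝔐r x))))

  record IsCohomological {v : Level} (F : IsRFinite M) (Φ : RawMackeyFunctor v) :
                         Set (suc ℓ ⊔ v ⊔ m) where
    open RawMackeyFunctor Φ
    open IsRFinite F using (index)
    field
      ind-res : ∀ {H I} (p : 𝔐 r H I) (q : 𝔐 i H I) x →
                ind q (res p x) ≈[ H ]
                _times_ (RawTopologicalGroup.rawMonoid (obj H)) (index p) x

record AbelianizationSystem {ℓ m : Level} {G : TopologicalGroup ℓ}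
                            (M : MackeySystem G m) (F : IsRFinite M) :
                            Set (suc ℓ ⊔ m) where
  open TopologicalGroup G using (Carrier; _∙_; _⁻¹)
  open MackeySystem M
  open IsRFinite F using (transversal)
  field
    R         : Obj → Subgroup G
    R-resp    : ∀ {H K} → ⌊ H ⌋ ≋ ⌊ K ⌋ → R H ≋ R K
    R-sub     : ∀ H → R H ≤ ⌊ H ⌋
    R-normal  : ∀ H {h x} → h ∈ mem ⌊ H ⌋ → x ∈ mem (R H) → (h ∙ x ∙ h ⁻¹) ∈ mem (R H)
    R-closed  : ∀ H → IsClosed (RawTopologicalGroup.rawSpace (subgroupRaw ⌊ H ⌋))
                               (mem (R H) ∘ proj₁)

  π : Obj → RawTopologicalGroup ℓ
  π H = quotientRaw ⌊ H ⌋ (R H)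

  private module π (H : Obj) = RawTopologicalGroup (π H)

  -- Independent of the transversal chosen, since I/R(I) is abelian.
  V : ∀ {H I} → 𝔐 r H I → Σ Carrier (mem ⌊ H ⌋) → π.Carrier I
  V {I = I} p = transfer (transversal p) (R I)

  field
    R-abelian : ∀ H → Commutative (π._≈_ H) (π._∙_ H)
    R-conj    : ∀ g H → R (g · H) ≋ conj g (R H)
    R-ker     : ∀ {H I} (p : 𝔐 r H I) {x} (x∈R : x ∈ mem (R H)) →
                π._≈_ I (V p (x , R-sub H x∈R)) (π.ε I)
    R-ind     : ∀ {H I} → 𝔐 i H I → R I ≤ R H

module _ {ℓ m : Level} {G : TopologicalGroup ℓ} {M : MackeySystem G m} {F : IsRFinite M} where

  open TopologicalGroup G using (_∙_; _⁻¹; group)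
  open MackeySystem M

  -- Only the underlying functions; that they descend to the quotients and
  -- are continuous homomorphisms is part of IsMackeyFunctor.
  πR : AbelianizationSystem M F → RawMackeyFunctor M ℓ
  πR A = record
    { obj  = π
    ; cast = λ e (x , x∈H) → x , to e x∈H
    ; res  = V
    ; ind  = λ q (x , x∈I) → x , 𝔐-sub q x∈I
    ; con  = λ g H (x , x∈H) → g ∙ x ∙ g ⁻¹ , (x , x∈H , Group.refl group)
    }
    where open AbelianizationSystem A

{-# OPTIONS --safe #-}
module Submission where

-- The transfer ∏ κ(tₖ h) may be computed in I/N from any transversal of I in H,
-- since two transversals differ by elements of I whose contributions cancel once
-- the factors commute. Each identity involving res is then obtained by a suitable
-- choice of transversal: u t for transitivity, g t g⁻¹ for conjugation, and r s with
-- r running over I\H/J and s over (Iʳ ∩ J)\J for the Mackey formula. Modulo R(H) the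
-- product of the tₖ h t_{σ(k)}⁻¹ is hⁿ, which makes the functor cohomological.

open import Defs hiding (r; i; to; from)
open import Algebra.Bundles using (AbelianGroup; CommutativeMonoid; Group; Monoid)
open import Algebra.Bundles.Raw using (RawMonoid)
open import Algebra.Definitions using (Commutative)
open import Algebra.Definitions.RawMonoid using (sum) renaming (_×_ to _times_)
open import Algebra.Morphism.Structures using (module GroupMorphisms; module MonoidMorphisms)
import Algebra.Properties.CommutativeMonoid.Sum as Sum
import Algebra.Properties.Monoid.Sum as MonoidSum
import Algebra.Properties.Group as GroupProperties
open import Algebra.Structures using (IsGroup)
open import Data.Bool.Base using (Bool; true; false; not)
import Data.Bool.Properties as Bool
open import Data.Empty using (⊥-elim)
open import Data.Fin.Base using (Fin; zero; suc)
open import Data.Fin.Patterns using (0F; 1F; 2F; 3F; 4F)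
import Data.Fin.Properties as Fin
open import Data.List.Base using (List; []; _∷_)
open import Data.Nat.Base using (ℕ; zero; suc)
open import Data.Product.Base using (Σ; Σ-syntax; _×_; _,_; proj₁; proj₂; uncurry)
open import Data.Unit.Polymorphic.Base using (tt)
open import Data.Vec.Base using (Vec; []; _∷_; lookup)
open import Function.Base using (_∘_; id)
open import Function.Bundles using (_↔_; Inverse; mk↔ₛ′)
open import Level using (Level)
open import Relation.Binary.PropositionalEquality as ≡ using (_≡_; _≢_)
import Relation.Binary.Reasoning.Setoid as SetoidReasoning
open import Relation.Nullary.Decidable using (yes; no)
open import Relation.Nullary.Negation using (¬_)
open import Relation.Unary using (Pred; _∈_; _⊆_)

-- `transfer` is tied to a chosen transversal and to the representatives its `cover` returns, so it
-- is rarely evaluated directly. Any equations s_k h = y_k s_{σ k} with y_k in I, over any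
-- transversal s, determine its value: `Factorization` records such data. Index sets other than
-- `Fin n` are allowed because the composite transversals are naturally indexed by pairs. An
-- identity for `res` then amounts to a transversal with a factorization whose y_k are the factors
-- on the other side, once con, ind or res has been moved inside the finite product. H/N has the
-- carrier of H with a coarser equality. Hence factors are compared in G itself, and N is needed in
-- that comparison only for commutativity. An open set of H/N is an open set of H that respects
-- congruence modulo N, so each continuity proof has a topological and a congruence half.

open Subgroup using (mem)

-- Deciding identities in the free group

infixl 7 _⊗_
infix 8 _⁻

data Word (n : ℕ) : Set where
  var : Fin n → Word n
  _⊗_ : Word n → Word n → Word n
  _⁻  : Word n → Word n

module _ {n : ℕ} where

  infixr 5 _◂_

  _◂_ : Bool × Fin n → List (Bool × Fin n) → List (Bool × Fin n)
  a       ◂ []            = a ∷ []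
  (s , i) ◂ (s′ , j) ∷ w with s Bool.≟ not s′ | i Fin.≟ j
  ... | yes _ | yes _ = w
  ... | yes _ | no _  = (s , i) ∷ (s′ , j) ∷ w
  ... | no _  | _     = (s , i) ∷ (s′ , j) ∷ w

  -- reduce true u w is the reduced form of u w, and reduce false u w that of u⁻¹ w.
  reduce : Bool → Word n → List (Bool × Fin n) → List (Bool × Fin n)
  reduce s     (var i) w = (s , i) ◂ w
  reduce true  (u ⊗ v) w = reduce true u (reduce true v w)
  reduce false (u ⊗ v) w = reduce false v (reduce false u w)
  reduce s     (u ⁻)   w = reduce (not s) u w

module WordSolver {c ℓ : Level} (G : Group c ℓ) where

  open Group G
  open GroupProperties G

  module _ {n : ℕ} (ρ : Vec Carrier n) where

    power : Bool → Carrier → Carrier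
    power true  x = x
    power false x = x ⁻¹

    ⟦_⟧ : Word n → Carrier
    ⟦ var i ⟧ = lookup ρ i
    ⟦ u ⊗ v ⟧ = ⟦ u ⟧ ∙ ⟦ v ⟧
    ⟦ u ⁻ ⟧   = ⟦ u ⟧ ⁻¹

    ⟦_⟧ʷ : List (Bool × Fin n) → Carrier
    ⟦ [] ⟧ʷ          = ε
    ⟦ (s , i) ∷ w ⟧ʷ = power s (lookup ρ i) ∙ ⟦ w ⟧ʷ

    power-not : ∀ s x → power (not s) x ≈ power s (x ⁻¹)
    power-not true  x = refl
    power-not false x = sym (⁻¹-involutive x)

    power-cancel : ∀ s x y → power (not s) x ∙ (power s x ∙ y) ≈ y
    power-cancel true  x y = \\-leftDividesʳ x y
    power-cancel false x y = \\-leftDividesˡ x y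

    ◂-correct : ∀ s i w → ⟦ (s , i) ◂ w ⟧ʷ ≈ power s (lookup ρ i) ∙ ⟦ w ⟧ʷ
    ◂-correct s i [] = refl
    ◂-correct s i ((s′ , j) ∷ w) with s Bool.≟ not s′ | i Fin.≟ j
    ... | yes ≡.refl | yes ≡.refl = sym (power-cancel s′ (lookup ρ i) _)
    ... | yes _      | no _       = refl
    ... | no _       | _          = refl

    -- Carrying the sign `s` avoids inverting lists: an inverse flips it, and (u v)⁻¹ = v⁻¹ u⁻¹ only
    -- swaps the two recursive calls.
    reduce-correct : ∀ s u w → ⟦ reduce s u w ⟧ʷ ≈ power s ⟦ u ⟧ ∙ ⟦ w ⟧ʷ
    reduce-correct s     (var i) w = ◂-correct s i w
    reduce-correct true  (u ⊗ v) w =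
      trans (reduce-correct true u _)
            (trans (∙-congˡ (reduce-correct true v w)) (sym (assoc _ _ _)))
    reduce-correct false (u ⊗ v) w =
      trans (reduce-correct false v _)
            (trans (∙-congˡ (reduce-correct false u w))
                   (trans (sym (assoc _ _ _)) (∙-congʳ (sym (⁻¹-anti-homo-∙ _ _)))))
    reduce-correct s     (u ⁻)   w =
      trans (reduce-correct (not s) u w) (∙-congʳ (power-not s ⟦ u ⟧))

    -- For concrete words both reductions compute, so the premise is proved by `≡.refl`. Only
    -- soundness of the reduction enters.
    solve : ∀ u v → reduce true u [] ≡ reduce true v [] → ⟦ u ⟧ ≈ ⟦ v ⟧
    solve u v e =
      trans (reduced u) (trans (reflexive (≡.cong ⟦_⟧ʷ e)) (sym (reduced v)))
      where
      reduced : ∀ u → ⟦ u ⟧ ≈ ⟦ reduce true u [] ⟧ʷ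
      reduced u = sym (trans (reduce-correct true u []) (identityʳ _))

-- Finite sums

module _ {c ℓ : Level} (A : CommutativeMonoid c ℓ) where

  private
    module A = CommutativeMonoid A
    module S = Sum A
  open A using (Carrier; _≈_; ε)

  sum-zero : ∀ {n} (f : Fin n → Carrier) → (∀ j → f j ≈ ε) → S.sum f ≈ ε
  sum-zero {n} f f≈ε = A.trans (S.sum-cong-≋ f≈ε) (S.sum-replicate-zero n)

  sum-one : ∀ {n} (f : Fin n → Carrier) k → (∀ j → j ≢ k → f j ≈ ε) →
            S.sum f ≈ f k
  sum-one {suc n} f zero    f≈ε =
    A.trans (A.∙-congˡ (sum-zero (f ∘ suc) λ j → f≈ε (suc j) λ ())) (A.identityʳ _)
  sum-one {suc n} f (suc k) f≈ε =
    A.trans (A.∙-cong (f≈ε zero λ ())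
                      (sum-one (f ∘ suc) k λ j j≢k → f≈ε (suc j) (j≢k ∘ Fin.suc-injective)))
            (A.identityˡ _)

  private
    δ : ∀ {n} → Fin n → Fin n → Carrier → Carrier
    δ i j x with i Fin.≟ j
    ... | yes _ = x
    ... | no _  = ε

    δ-yes : ∀ {n} {i j : Fin n} {x} → i ≡ j → δ i j x ≈ x
    δ-yes {i = i} {j} i≡j with i Fin.≟ j
    ... | yes _  = A.refl
    ... | no i≢j = ⊥-elim (i≢j i≡j)

    δ-no : ∀ {n} {i j : Fin n} {x} → i ≢ j → δ i j x ≈ ε
    δ-no {i = i} {j} i≢j with i Fin.≟ j
    ... | yes i≡j = ⊥-elim (i≢j i≡j)
    ... | no _    = A.refl

  -- Both sides equal the sum of δ (φ (k , l)) i (f i) over all i, k and l.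
  sum-Σ : ∀ {m n} {c : Fin m → ℕ} (φ : Σ (Fin m) (Fin ∘ c) ↔ Fin n) (f : Fin n → Carrier) →
          S.sum (λ k → S.sum λ l → f (Inverse.to φ (k , l))) ≈ S.sum f
  sum-Σ {m} {n} {c} φ f = begin
    S.sum (λ k → S.sum λ l → f (to (k , l)))
      ≈⟨ S.sum-cong-≋ (λ k → S.sum-cong-≋ λ l → A.sym (select (to (k , l)))) ⟩
    S.sum (λ k → S.sum λ l → S.sum λ i → δ (to (k , l)) i (f i))
      ≈⟨ S.sum-cong-≋ (λ k → S.∑-comm {c k} {n} λ l i → δ (to (k , l)) i (f i)) ⟩
    S.sum (λ k → S.sum λ i → S.sum λ l → δ (to (k , l)) i (f i))
      ≈⟨ S.∑-comm (λ k i → S.sum λ l → δ (to (k , l)) i (f i)) ⟩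
    S.sum (λ i → S.sum λ k → S.sum λ l → δ (to (k , l)) i (f i))
      ≈⟨ S.sum-cong-≋ collect ⟩
    S.sum f ∎
    where
    open SetoidReasoning A.setoid
    open Inverse φ using (to; from; strictlyInverseˡ; strictlyInverseʳ)

    select : ∀ j → S.sum (λ i → δ j i (f i)) ≈ f j
    select j = A.trans (sum-one _ j λ i i≢j → δ-no (i≢j ∘ ≡.sym)) (δ-yes {i = j} ≡.refl)

    -- (k₀ , l₀) is the only pair sent to i, so each of the two sums keeps a single term.
    collect : ∀ i → S.sum (λ k → S.sum λ l → δ (to (k , l)) i (f i)) ≈ f i
    collect i = begin
      S.sum (λ k → S.sum λ l → δ (to (k , l)) i (f i))
        ≈⟨ sum-one _ k₀ (λ k k≢k₀ → sum-zero (λ l → δ (to (k , l)) i (f i))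
             λ l → δ-no λ e → k≢k₀ (≡.cong proj₁ (back e))) ⟩
      S.sum (λ l → δ (to (k₀ , l)) i (f i))
        ≈⟨ sum-one _ l₀ (λ l l≢l₀ → δ-no λ e → l≢l₀ (fibre (back e))) ⟩
      δ (to (k₀ , l₀)) i (f i)
        ≈⟨ δ-yes (strictlyInverseˡ i) ⟩
      f i ∎
      where
      k₀ = proj₁ (from i)
      l₀ = proj₂ (from i)

      back : ∀ {p} → to p ≡ i → p ≡ (k₀ , l₀)
      back {p} e = ≡.trans (≡.sym (strictlyInverseʳ p)) (≡.cong from e)

      fibre : ∀ {l l′ : Fin (c k₀)} → (k₀ , l) ≡ (k₀ , l′) → l ≡ l′
      fibre ≡.refl = ≡.refl

module _ {c ℓ : Level} (A : AbelianGroup c ℓ) where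

  open AbelianGroup A
  private module S = Sum commutativeMonoid
  open SetoidReasoning setoid

  -- The b_{σ j} are the b_j permuted, so their inverses cancel the b_j. It serves twice: in I/N,
  -- with b the offset between two transversals, and in H/R(H), with b the transversal itself, for
  -- the index formula.
  sum-coboundary : ∀ {n} (b x : Fin n → Carrier) (σ : Fin n ↔ Fin n) →
                   S.sum (λ j → b j ∙ x j ∙ b (Inverse.to σ j) ⁻¹) ≈ S.sum x
  sum-coboundary b x σ = begin
    S.sum (λ j → b j ∙ x j ∙ b (Inverse.to σ j) ⁻¹)
      ≈⟨ S.∑-distrib-+ (λ j → b j ∙ x j) (λ j → b (Inverse.to σ j) ⁻¹) ⟩
    S.sum (λ j → b j ∙ x j) ∙ S.sum (λ j → b (Inverse.to σ j) ⁻¹)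
      ≈⟨ ∙-cong (S.∑-distrib-+ b x) (sym (S.sum-permute (λ j → b j ⁻¹) σ)) ⟩
    S.sum b ∙ S.sum x ∙ S.sum (λ j → b j ⁻¹)
      ≈⟨ ∙-congʳ (comm _ _) ⟩
    S.sum x ∙ S.sum b ∙ S.sum (λ j → b j ⁻¹)
      ≈⟨ assoc _ _ _ ⟩
    S.sum x ∙ (S.sum b ∙ S.sum (λ j → b j ⁻¹))
      ≈⟨ ∙-congˡ (S.∑-distrib-+ b (λ j → b j ⁻¹)) ⟨
    S.sum x ∙ S.sum (λ j → b j ∙ b j ⁻¹)
      ≈⟨ ∙-congˡ (sum-zero commutativeMonoid _ (λ j → inverseʳ (b j))) ⟩
    S.sum x ∙ ε
      ≈⟨ identityʳ _ ⟩
    S.sum x ∎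

  module _ {n} (b x : Fin n → Carrier) (σ : Fin n ↔ Fin n) where

    private
      x′ : Fin n → Carrier
      x′ j = b j ∙ x j ∙ b (Inverse.to σ j) ⁻¹

    sum-cohomologous : ∀ {m} (φ : Fin m ↔ Fin n) (y : Fin m → Carrier) →
                       (∀ k → y k ≈ x′ (Inverse.to φ k)) → S.sum x ≈ S.sum y
    sum-cohomologous φ y y≈x′ = begin
      S.sum x                    ≈⟨ sum-coboundary b x σ ⟨
      S.sum x′                   ≈⟨ S.sum-permute x′ φ ⟩
      S.sum (x′ ∘ Inverse.to φ)  ≈⟨ S.sum-cong-≋ y≈x′ ⟨
      S.sum y                    ∎

    sum-cohomologous-Σ : ∀ {m} {c : Fin m → ℕ} (φ : Σ (Fin m) (Fin ∘ c) ↔ Fin n)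
                         (y : Σ (Fin m) (Fin ∘ c) → Carrier) →
                         (∀ k → y k ≈ x′ (Inverse.to φ k)) →
                         S.sum x ≈ S.sum (λ k → S.sum (λ l → y (k , l)))
    sum-cohomologous-Σ φ y y≈x′ = begin
      S.sum x
        ≈⟨ sum-coboundary b x σ ⟨
      S.sum x′
        ≈⟨ sum-Σ commutativeMonoid φ x′ ⟨
      S.sum (λ k → S.sum (λ l → x′ (Inverse.to φ (k , l))))
        ≈⟨ S.sum-cong-≋ (λ k → S.sum-cong-≋ (λ l → y≈x′ (k , l))) ⟨
      S.sum (λ k → S.sum (λ l → y (k , l))) ∎

  -- The factors of a product x y are κ(t_k x) κ(t_{σ k} y) with σ the permutation of x; this
  -- separates the two families.
  sum-∙-permute : ∀ {n} (x y : Fin n → Carrier) (σ : Fin n ↔ Fin n) →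
                  S.sum (λ k → x k ∙ y (Inverse.to σ k)) ≈ S.sum x ∙ S.sum y
  sum-∙-permute x y σ =
    trans (S.∑-distrib-+ x (y ∘ Inverse.to σ)) (∙-congˡ (sym (S.sum-permute y σ)))

sum-homo : ∀ {a b ℓ₁ ℓ₂} (A : RawMonoid a ℓ₁) (B : Monoid b ℓ₂)
           {f : RawMonoid.Carrier A → Monoid.Carrier B} →
           MonoidMorphisms.IsMonoidHomomorphism A (Monoid.rawMonoid B) f →
           ∀ {n} (x : Fin n → RawMonoid.Carrier A) →
           Monoid._≈_ B (f (sum A x)) (sum (Monoid.rawMonoid B) (f ∘ x))
sum-homo A B f-homo {zero}  x = MonoidMorphisms.IsMonoidHomomorphism.ε-homo f-homo
sum-homo A B f-homo {suc n} x =
  B.trans (homo _ _) (B.∙-congˡ (sum-homo A B f-homo (x ∘ suc)))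
  where
  module B = Monoid B
  open MonoidMorphisms.IsMonoidHomomorphism f-homo

module _ {a b ℓ₁ ℓ₂ : Level} (A : Group a ℓ₁) (B : Group b ℓ₂) where

  private
    module A = Group A
    module B = Group B
  open GroupProperties B using (identityʳ-unique; inverseˡ-unique)

  -- f ε is idempotent, hence ε by cancellation, and inverses follow. For the transfer only
  -- congruence and multiplicativity then remain.
  homo⇒isGroupHomomorphism :
    ∀ {f : A.Carrier → B.Carrier} → (∀ {x y} → x A.≈ y → f x B.≈ f y) →
    (∀ x y → f (x A.∙ y) B.≈ f x B.∙ f y) →
    GroupMorphisms.IsGroupHomomorphism A.rawGroup B.rawGroup f
  homo⇒isGroupHomomorphism {f} f-cong homo = record
    { isMonoidHomomorphism = record
      { isMagmaHomomorphism = record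
        { isRelHomomorphism = record { cong = f-cong } ; homo = homo }
      ; ε-homo = ε-homo
      }
    ; ⁻¹-homo = λ x → inverseˡ-unique _ _
        (B.trans (B.sym (homo _ _)) (B.trans (f-cong (A.inverseˡ x)) ε-homo))
    }
    where
    ε-homo : f A.ε B.≈ B.ε
    ε-homo = identityʳ-unique _ _ (B.trans (B.sym (homo _ _)) (f-cong (A.identityʳ A.ε)))

module _ {ℓ : Level} {G : TopologicalGroup ℓ} where

  open TopologicalGroup G
  open Group group using (setoid; refl; sym; trans; reflexive; assoc; identityˡ; identityʳ; inverseˡ; inverseʳ;
                          ∙-cong; ∙-congˡ; ∙-congʳ; ⁻¹-cong)
  open GroupProperties group using (x≈y⇒x∙y⁻¹≈ε; ∙-cancelˡ; ∙-cancelʳ; //-rightDividesˡ)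
  open IsTopology isTopology
  open WordSolver group using (solve)

  -- Open sets and continuous maps

  -- U is the union of the neighbourhoods that `nbhd` returns, indexed by points together with
  -- membership proofs, so nothing has to be chosen.
  open-local : ∀ {U : Pred Carrier ℓ} →
               (∀ {x} → x ∈ U → Σ[ V ∈ Pred Carrier ℓ ] IsOpen V × x ∈ V × V ⊆ U) →
               IsOpen U
  open-local {U} nbhd = open-resp-≐
    ( (λ ((x , x∈U) , y∈V) → proj₂ (proj₂ (proj₂ (nbhd x∈U))) y∈V)
    , λ {x} x∈U → (x , x∈U) , proj₁ (proj₂ (proj₂ (nbhd x∈U))))
    (open-⋃ {A = Σ Carrier U} {λ (x , x∈U) → proj₁ (nbhd x∈U)}
            λ (x , x∈U) → proj₁ (proj₂ (nbhd x∈U)))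

  open-⋂ : ∀ {n} (U : Fin n → Pred Carrier ℓ) → (∀ k → IsOpen (U k)) →
           IsOpen (λ x → ∀ k → x ∈ U k)
  open-⋂ {zero}  U U-open = open-resp-≐ ((λ _ ()) , λ _ → tt) open-whole
  open-⋂ {suc n} U U-open = open-resp-≐
    ((λ { (p , q) zero → p ; (p , q) (suc k) → q k }) , λ p → p zero , p ∘ suc)
    (open-∩ (U-open zero) (open-⋂ (U ∘ suc) (U-open ∘ suc)))

  -- The preimage of W cannot be decided to be empty or everything. It is open locally: once a proof
  -- of a ∈ W is at hand, the whole space is a neighbourhood.
  const-continuous : ∀ a → Continuous rawSpace rawSpace (λ _ → a)
  const-continuous a W-open = open-local λ a∈W → _ , open-whole , tt , λ _ → a∈W

  product-continuous : ∀ {f g} → Continuous rawSpace rawSpace f →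
                       Continuous rawSpace rawSpace g →
                       Continuous rawSpace rawSpace (λ x → f x ∙ g x)
  product-continuous f-cont g-cont W-open = open-local λ fg∈W →
    let V , V′ , V-open , V′-open , fx∈V , gx∈V′ , V×V′⊆W = ∙-continuous W-open fg∈W
    in _ , open-∩ (f-cont V-open) (g-cont V′-open) , (fx∈V , gx∈V′) ,
       λ (fy∈V , gy∈V′) → V×V′⊆W fy∈V gy∈V′

  sandwich-continuous : ∀ a b → Continuous rawSpace rawSpace (λ x → a ∙ x ∙ b)
  sandwich-continuous a b =
    product-continuous (product-continuous (const-continuous a) id) (const-continuous b)

  sum-continuous : ∀ {n} {f : Fin n → Carrier → Carrier} →
                   (∀ k → Continuous rawSpace rawSpace (f k)) →
                   Continuous rawSpace rawSpace (λ x → sum rawMonoid λ k → f k x)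
  sum-continuous {zero}  f-cont = const-continuous ε
  sum-continuous {suc n} f-cont =
    product-continuous (f-cont zero) (sum-continuous (f-cont ∘ suc))

  -- Cosets

  infix 4 _∼[_]_

  -- I x = I y; for x and y in H this is the equality of quotientRaw H I.
  _∼[_]_ : Carrier → Subgroup G → Carrier → Set ℓ
  x ∼[ I ] y = (x ∙ y ⁻¹) ∈ mem I

  module _ (I : Subgroup G) where

    private module I = Subgroup I

    ∼-reflexive : ∀ {x y} → x ≈ y → x ∼[ I ] y
    ∼-reflexive x≈y = I.resp (sym (x≈y⇒x∙y⁻¹≈ε x≈y)) I.ε-closed

    ∼-sym : ∀ {x y} → x ∼[ I ] y → y ∼[ I ] x
    ∼-sym {x} {y} p = I.resp
      (solve (x ∷ y ∷ []) ((var 0F ⊗ var 1F ⁻) ⁻) (var 1F ⊗ var 0F ⁻) ≡.refl)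
      (I.⁻¹-closed p)

    ∼-trans : ∀ {x y z} → x ∼[ I ] y → y ∼[ I ] z → x ∼[ I ] z
    ∼-trans {x} {y} {z} p q = I.resp
      (solve (x ∷ y ∷ z ∷ []) (var 0F ⊗ var 1F ⁻ ⊗ (var 1F ⊗ var 2F ⁻))
             (var 0F ⊗ var 2F ⁻) ≡.refl)
      (I.∙-closed p q)

    ∼-∙ʳ : ∀ {x y} z → x ∼[ I ] y → x ∙ z ∼[ I ] y ∙ z
    ∼-∙ʳ {x} {y} z = I.resp
      (solve (x ∷ y ∷ z ∷ []) (var 0F ⊗ var 1F ⁻)
             (var 0F ⊗ var 2F ⊗ (var 1F ⊗ var 2F) ⁻) ≡.refl)

    ∼-∙ˡ : ∀ {a} x → a ∈ mem I → a ∙ x ∼[ I ] x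
    ∼-∙ˡ {a} x = I.resp
      (solve (a ∷ x ∷ []) (var 0F) (var 0F ⊗ var 1F ⊗ var 1F ⁻) ≡.refl)

  -- Topological quotient groups

  record IsAbelianQuotient (H N : Subgroup G) : Set ℓ where
    private
      module H = Subgroup H
      module N = Subgroup N
      module H/N = RawTopologicalGroup (quotientRaw H N)
    field
      sub    : N ≤ H
      normal : ∀ {h x} → h ∈ mem H → x ∈ mem N → (h ∙ x ∙ h ⁻¹) ∈ mem N
      comm   : Commutative H/N._≈_ H/N._∙_

    ∼-∙ˡ-normal : ∀ {h x y} → h ∈ mem H → x ∼[ N ] y → h ∙ x ∼[ N ] h ∙ y
    ∼-∙ˡ-normal {h} {x} {y} h∈H p = N.resp
      (solve (h ∷ x ∷ y ∷ []) (var 0F ⊗ (var 1F ⊗ var 2F ⁻) ⊗ var 0F ⁻)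
             (var 0F ⊗ var 1F ⊗ (var 0F ⊗ var 2F) ⁻) ≡.refl)
      (normal h∈H p)

    ∼-⁻¹ : ∀ {x y} → x ∈ mem H → x ∼[ N ] y → x ⁻¹ ∼[ N ] y ⁻¹
    ∼-⁻¹ {x} {y} x∈H p = N.resp
      (solve (x ∷ y ∷ []) (var 0F ⁻ ⊗ (var 0F ⊗ var 1F ⁻) ⁻ ⊗ var 0F ⁻ ⁻)
             (var 0F ⁻ ⊗ var 1F ⁻ ⁻) ≡.refl)
      (normal (H.⁻¹-closed x∈H) (N.⁻¹-closed p))

    isGroupQuotient : IsGroup H/N._≈_ H/N._∙_ H/N.ε H/N._⁻¹
    isGroupQuotient = record
      { isMonoid = record
        { isSemigroup = record
          { isMagma = record
            { isEquivalence = record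
              { refl  = ∼-reflexive N refl
              ; sym   = ∼-sym N
              ; trans = ∼-trans N
              }
            ; ∙-cong = λ {_} {y} {u} {_} p q →
                ∼-trans N (∼-∙ʳ N (proj₁ u) p) (∼-∙ˡ-normal (proj₂ y) q)
            }
          ; assoc = λ x y z → ∼-reflexive N (assoc _ _ _)
          }
        ; identity = (λ x → ∼-reflexive N (identityˡ _))
                   , (λ x → ∼-reflexive N (identityʳ _))
        }
      ; inverse = (λ x → ∼-reflexive N (inverseˡ _))
                , (λ x → ∼-reflexive N (inverseʳ _))
      ; ⁻¹-cong = λ {x} → ∼-⁻¹ (proj₂ x)
      }

    abelianGroup : AbelianGroup ℓ ℓ
    abelianGroup = record { isAbelianGroup = record { isGroup = isGroupQuotient ; comm = comm } }

    isTopologyQuotient : IsTopology H/N.rawSpace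
    isTopologyQuotient = record
      { isEquivalence = IsGroup.isEquivalence isGroupQuotient
      ; open-resp-≈   = proj₁
      ; open-resp-≐   = λ (U⊆V , V⊆U) (U-resp , W , W-open , U⊆W , W⊆U) →
          (λ p → U⊆V ∘ U-resp p ∘ V⊆U) , W , W-open , U⊆W ∘ V⊆U , U⊆V ∘ W⊆U
      ; open-whole    = (λ _ _ → tt) , _ , open-whole , (λ _ → tt) , (λ _ → tt)
      ; open-∩        = λ (U-resp , W , W-open , U⊆W , W⊆U) (V-resp , W′ , W′-open , V⊆W′ , W′⊆V) →
          (λ p (u , v) → U-resp p u , V-resp p v) , _ , open-∩ W-open W′-open ,
          (λ (u , v) → U⊆W u , V⊆W′ v) , (λ (w , w′) → W⊆U w , W′⊆V w′)
      ; open-⋃        = λ U-open →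
          (λ p (a , u) → a , proj₁ (U-open a) p u) ,
          _ , open-⋃ (λ a → proj₁ (proj₂ (proj₂ (U-open a)))) ,
          (λ (a , u) → a , proj₁ (proj₂ (proj₂ (proj₂ (U-open a)))) u) ,
          (λ (a , w) → a , proj₂ (proj₂ (proj₂ (proj₂ (U-open a)))) w)
      }

    saturation : Pred Carrier ℓ → Pred Carrier ℓ
    saturation W x = Σ[ n ∈ Σ Carrier (mem N) ] (proj₁ n ∙ x) ∈ W

    -- The projection to H/N is open, since the saturation of W is the union of the translates n⁻¹
    -- W.
    saturation-open : ∀ {W} → IsOpen W → H/N.IsOpen (saturation W ∘ proj₁)
    saturation-open {W} W-open =
      (λ { {x , _} {y , _} p ((n , n∈N) , nx∈W) →
           -- Chosen so that this element times y is n x, which lies in W.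
           (n ∙ (x ∙ y ⁻¹) , N.∙-closed n∈N p) ,
           open-resp-≈ W-open
             (solve (n ∷ x ∷ y ∷ []) (var 0F ⊗ var 1F)
                    (var 0F ⊗ (var 1F ⊗ var 2F ⁻) ⊗ var 2F) ≡.refl) nx∈W }) ,
      saturation W ,
      open-⋃ (λ (n , _) → product-continuous (const-continuous n) id W-open) , id , id

    isTopologicalAbelianGroup : IsTopologicalAbelianGroup (quotientRaw H N)
    isTopologicalAbelianGroup = record
      { isTopologicalGroup = record
        { isGroup       = isGroupQuotient
        ; isTopology    = isTopologyQuotient
        ; ∙-continuous  = mul
        ; ⁻¹-continuous = λ (U-resp , W , W-open , U⊆W , W⊆U) →
            (λ {x} p → U-resp (∼-⁻¹ (proj₂ x) p)) ,
            _ , ⁻¹-continuous W-open , U⊆W , W⊆U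
        }
      ; comm = comm
      }
      where
      -- V and V′ are neighbourhoods in G only; saturating them makes them neighbourhoods in H/N. A
      -- point (a , b) of the saturations is congruent to (n a , n′ b) in V × V′, and U respects
      -- congruence.
      mul : Continuous (productSpace H/N.rawSpace H/N.rawSpace) H/N.rawSpace (uncurry H/N._∙_)
      mul (U-resp , W , W-open , U⊆W , W⊆U) {x , _} {y , _} xy∈U =
        let V , V′ , V-open , V′-open , x∈V , y∈V′ , V×V′⊆W = ∙-continuous W-open (U⊆W xy∈U)
            ε∙ : ∀ {W z} → IsOpen W → z ∈ W → (ε ∙ z) ∈ W
            ε∙ W-open = open-resp-≈ W-open (sym (identityˡ _))
        in _ , _ , saturation-open V-open , saturation-open V′-open ,
           ((ε , N.ε-closed) , ε∙ V-open x∈V) , ((ε , N.ε-closed) , ε∙ V′-open y∈V′) ,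
           λ { {a , a∈H} {b , b∈H} ((n , n∈N) , na∈V) ((n′ , n′∈N) , n′b∈V′) →
               let na∈H   = H.∙-closed (sub n∈N) a∈H
                   n′b∈H  = H.∙-closed (sub n′∈N) b∈H
               in U-resp {n ∙ a ∙ (n′ ∙ b) , H.∙-closed na∈H n′b∈H}
                    (IsGroup.∙-cong isGroupQuotient
                      {n ∙ a , na∈H} {a , a∈H} {n′ ∙ b , n′b∈H} {b , b∈H}
                      (∼-∙ˡ N a n∈N) (∼-∙ˡ N b n′∈N))
                    (W⊆U (V×V′⊆W na∈V n′b∈V′)) }


  -- All the maps cast, ind and con, and their composites, are of this form.
  conjugation-homomorphism :
    ∀ (K L N N′ : Subgroup G) g (f : Σ Carrier (mem K) → Σ Carrier (mem L)) →
    (∀ x → proj₁ (f x) ≈ g ∙ proj₁ x ∙ g ⁻¹) →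
    (∀ {x} → x ∈ mem N → (g ∙ x ∙ g ⁻¹) ∈ mem N′) →
    IsContinuousHomomorphism (quotientRaw K N) (quotientRaw L N′) f
  conjugation-homomorphism K L N N′ g f f≈ gNg⁻¹⊆N′ = record
    { isGroupHomomorphism = record
      { isMonoidHomomorphism = record
        { isMagmaHomomorphism = record
          { isRelHomomorphism = record { cong = f-cong }
          ; homo = λ x y → ∼-reflexive N′ (begin
              proj₁ (f (x K/N.∙ y))
                ≈⟨ f≈ (x K/N.∙ y) ⟩
              g ∙ (proj₁ x ∙ proj₁ y) ∙ g ⁻¹
                ≈⟨ solve (g ∷ proj₁ x ∷ proj₁ y ∷ []) (var 0F ⊗ (var 1F ⊗ var 2F) ⊗ var 0F ⁻)
                     (var 0F ⊗ var 1F ⊗ var 0F ⁻ ⊗ (var 0F ⊗ var 2F ⊗ var 0F ⁻)) ≡.refl ⟩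
              (g ∙ proj₁ x ∙ g ⁻¹) ∙ (g ∙ proj₁ y ∙ g ⁻¹)
                ≈⟨ ∙-cong (f≈ x) (f≈ y) ⟨
              proj₁ (f x) ∙ proj₁ (f y) ∎)
          }
        ; ε-homo = ∼-reflexive N′
            (trans (f≈ K/N.ε) (trans (∙-congʳ (identityʳ g)) (inverseʳ g)))
        }
      ; ⁻¹-homo = λ x → ∼-reflexive N′ (begin
          proj₁ (f (x K/N.⁻¹))
            ≈⟨ f≈ (x K/N.⁻¹) ⟩
          g ∙ proj₁ x ⁻¹ ∙ g ⁻¹
            ≈⟨ solve (g ∷ proj₁ x ∷ []) (var 0F ⊗ var 1F ⁻ ⊗ var 0F ⁻)
                 ((var 0F ⊗ var 1F ⊗ var 0F ⁻) ⁻) ≡.refl ⟩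
          (g ∙ proj₁ x ∙ g ⁻¹) ⁻¹
            ≈⟨ ⁻¹-cong (f≈ x) ⟨
          proj₁ (f x) ⁻¹ ∎)
      }
    ; continuous = λ (U-resp , W , W-open , U⊆W , W⊆U) →
        (λ {x} {y} p → U-resp (f-cong {x} {y} p)) ,
        _ , sandwich-continuous g (g ⁻¹) W-open ,
        (λ {x} u → open-resp-≈ W-open (f≈ x) (U⊆W u)) ,
        (λ {x} w → W⊆U (open-resp-≈ W-open (sym (f≈ x)) w))
    }
    where
    open SetoidReasoning setoid
    module K/N = RawTopologicalGroup (quotientRaw K N)

    f-cong : ∀ {x y} → proj₁ x ∼[ N ] proj₁ y → proj₁ (f x) ∼[ N′ ] proj₁ (f y)
    f-cong {x} {y} p = Subgroup.resp N′ (begin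
      g ∙ (proj₁ x ∙ proj₁ y ⁻¹) ∙ g ⁻¹
        ≈⟨ solve (g ∷ proj₁ x ∷ proj₁ y ∷ []) (var 0F ⊗ (var 1F ⊗ var 2F ⁻) ⊗ var 0F ⁻)
             (var 0F ⊗ var 1F ⊗ var 0F ⁻ ⊗ (var 0F ⊗ var 2F ⊗ var 0F ⁻) ⁻) ≡.refl ⟩
      (g ∙ proj₁ x ∙ g ⁻¹) ∙ (g ∙ proj₁ y ∙ g ⁻¹) ⁻¹
        ≈⟨ ∙-cong (f≈ x) (⁻¹-cong (f≈ y)) ⟨
      proj₁ (f x) ∙ proj₁ (f y) ⁻¹ ∎) (gNg⁻¹⊆N′ p)

  inclusion-homomorphism :
    ∀ (K L N N′ : Subgroup G) (K≤L : K ≤ L) → N ≤ N′ →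
    IsContinuousHomomorphism (quotientRaw K N) (quotientRaw L N′) (λ x → proj₁ x , K≤L (proj₂ x))
  inclusion-homomorphism K L N N′ K≤L N≤N′ = conjugation-homomorphism K L N N′ ε _
    (λ x → sym (conj-ε (proj₁ x)))
    (λ {x} x∈N → Subgroup.resp N′ (sym (conj-ε x)) (N≤N′ x∈N))
    where
    open SetoidReasoning setoid

    conj-ε : ∀ x → ε ∙ x ∙ ε ⁻¹ ≈ x
    conj-ε x = begin
      ε ∙ x ∙ ε ⁻¹ ≈⟨ ∙-cong (identityˡ x) (GroupProperties.ε⁻¹≈ε group) ⟩
      x ∙ ε        ≈⟨ identityʳ x ⟩
      x            ∎

  -- Transversals

  record IsTransversal (H I : Subgroup G) {K : Set} (s : K → Carrier) : Set ℓ where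
    field
      s∈H    : ∀ k → s k ∈ mem H
      cover  : ∀ {h} → h ∈ mem H → Σ[ k ∈ K ] h ∼[ I ] s k
      unique : ∀ {k l} → s k ∼[ I ] s l → k ≡ l

    factor-unique : ∀ {a b k l} → a ∈ mem I → b ∈ mem I → a ∙ s k ≈ b ∙ s l → k ≡ l
    factor-unique {k = k} {l} a∈I b∈I e = unique
      (∼-trans I (∼-sym I (∼-∙ˡ I (s k) a∈I))
                 (∼-trans I (∼-reflexive I e) (∼-∙ˡ I (s l) b∈I)))

  isTransversal : ∀ {H I} (T : RightTransversal H I) →
                  IsTransversal H I (RightTransversal.t T)
  isTransversal {I = I} T = record
    { s∈H    = t∈H
    ; cover  = cover
    ; unique = λ {k} → unique (t∈H k) (∼-reflexive I refl)
    }
    where open RightTransversal T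

  -- Neither σ nor y has to come from `κ`; over a transversal the equation `factor` determines both.
  -- Right multiplication by h on the right cosets of I is σ.
  record Factorization (I : Subgroup G) {K : Set} (s : K → Carrier) (h : Carrier) : Set ℓ where
    field
      σ      : K → K
      y      : K → Σ Carrier (mem I)
      factor : ∀ k → s k ∙ h ≈ proj₁ (y k) ∙ s (σ k)

  κ-factorization : ∀ {H I} (T : RightTransversal H I) ((h , h∈H) : Σ Carrier (mem H)) →
                    Factorization I (RightTransversal.t T) h
  κ-factorization {H} T (h , h∈H) = record
    { σ      = λ k → proj₁ (cover (Subgroup.∙-closed H (t∈H k) h∈H))
    ; y      = λ k → κ (Subgroup.∙-closed H (t∈H k) h∈H)
    ; factor = λ k → sym (//-rightDividesˡ _ _)
    }
    where open RightTransversal T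

  -- The cocycle identity behind multiplicativity of the transfer.
  factorization-∙ : ∀ {I} {K : Set} {s : K → Carrier} {x y} →
                    Factorization I s x → Factorization I s y → Factorization I s (x ∙ y)
  factorization-∙ {I} {s = s} {x} {y} Φ Ψ = record
    { σ      = Ψ.σ ∘ Φ.σ
    ; y      = λ k → proj₁ (Φ.y k) ∙ proj₁ (Ψ.y (Φ.σ k)) ,
                     Subgroup.∙-closed I (proj₂ (Φ.y k)) (proj₂ (Ψ.y (Φ.σ k)))
    ; factor = λ k → begin
        s k ∙ (x ∙ y)                                            ≈⟨ assoc _ _ _ ⟨
        s k ∙ x ∙ y                                              ≈⟨ ∙-congʳ (Φ.factor k) ⟩
        proj₁ (Φ.y k) ∙ s (Φ.σ k) ∙ y                            ≈⟨ assoc _ _ _ ⟩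
        proj₁ (Φ.y k) ∙ (s (Φ.σ k) ∙ y)                          ≈⟨ ∙-congˡ (Ψ.factor (Φ.σ k)) ⟩
        proj₁ (Φ.y k) ∙ (proj₁ (Ψ.y (Φ.σ k)) ∙ s (Ψ.σ (Φ.σ k)))  ≈⟨ assoc _ _ _ ⟨
        proj₁ (Φ.y k) ∙ proj₁ (Ψ.y (Φ.σ k)) ∙ s (Ψ.σ (Φ.σ k))    ∎
    }
    where
    open SetoidReasoning setoid
    module Φ = Factorization Φ
    module Ψ = Factorization Ψ

  module _ {H I : Subgroup G} {K : Set} {s : K → Carrier} (S : IsTransversal H I s) where

    open IsTransversal S
    private
      module H = Subgroup H
      module I = Subgroup I

    -- The inverse is right multiplication by h⁻¹ on cosets. Only `σ∘τ` is computed; the other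
    -- composite follows from injectivity of σ.
    σ-bijective : ∀ {h} → h ∈ mem H → Factorization I s h → K ↔ K
    σ-bijective {h} h∈H Φ = mk↔ₛ′ σ τ σ∘τ (λ k → σ-injective (σ∘τ (σ k)))
      where
      open SetoidReasoning setoid
      open Factorization Φ

      σ-injective : ∀ {k l} → σ k ≡ σ l → k ≡ l
      σ-injective {k} {l} σk≡σl = unique (I.resp
        (begin
          proj₁ (y k) ∙ proj₁ (y l) ⁻¹
            ≈⟨ solve (proj₁ (y k) ∷ proj₁ (y l) ∷ s (σ k) ∷ []) (var 0F ⊗ var 1F ⁻)
                 (var 0F ⊗ var 2F ⊗ (var 1F ⊗ var 2F) ⁻) ≡.refl ⟩
          proj₁ (y k) ∙ s (σ k) ∙ (proj₁ (y l) ∙ s (σ k)) ⁻¹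
            ≈⟨ ∙-cong (factor k) (⁻¹-cong (trans (factor l)
                 (∙-congˡ (reflexive (≡.cong s (≡.sym σk≡σl)))))) ⟨
          s k ∙ h ∙ (s l ∙ h) ⁻¹
            ≈⟨ solve (s k ∷ s l ∷ h ∷ []) (var 0F ⊗ var 2F ⊗ (var 1F ⊗ var 2F) ⁻)
                 (var 0F ⊗ var 1F ⁻) ≡.refl ⟩
          s k ∙ s l ⁻¹ ∎)
        (I.∙-closed (proj₂ (y k)) (I.⁻¹-closed (proj₂ (y l)))))

      sh⁻¹ : ∀ k → Σ[ l ∈ K ] s k ∙ h ⁻¹ ∼[ I ] s l
      sh⁻¹ k = cover (H.∙-closed (s∈H k) (H.⁻¹-closed h∈H))

      τ : K → K
      τ k = proj₁ (sh⁻¹ k)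

      σ∘τ : ∀ k → σ (τ k) ≡ k
      σ∘τ k = ≡.sym (unique
        (∼-trans I (∼-reflexive I (sym (//-rightDividesˡ h (s k))))
        (∼-trans I (∼-∙ʳ I h (proj₂ (sh⁻¹ k)))
        (∼-trans I (∼-reflexive I (factor (τ k))) (∼-∙ˡ I _ (proj₂ (y (τ k))))))))

  -- Writing s_{d j} = b_j t_j with b the offset, the factors of the two transversals
  -- differ by the coboundary b_j b_{σ j}⁻¹, whose product over j is trivial.
  module _ {H I : Subgroup G} (N : Subgroup G) {h : Carrier}
           {K : Set} {s : K → Carrier} (S : IsTransversal H I s) (Φ : Factorization I s h)
           {n : ℕ} {t : Fin n → Carrier} (T : IsTransversal H I t) (Ψ : Factorization I t h) where

    private
      module S = IsTransversal S
      module T = IsTransversal T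
      module Φ = Factorization Φ
      module Ψ = Factorization Ψ
      module I/N = RawTopologicalGroup (quotientRaw I N)

      e : K → Fin n
      e k = proj₁ (T.cover (S.s∈H k))

      d : Fin n → K
      d j = proj₁ (S.cover (T.s∈H j))

      e∘d : ∀ j → e (d j) ≡ j
      e∘d j = ≡.sym (T.unique (∼-trans I (proj₂ (S.cover (T.s∈H j))) (proj₂ (T.cover (S.s∈H (d j))))))

      d∘e : ∀ k → d (e k) ≡ k
      d∘e k = ≡.sym (S.unique (∼-trans I (proj₂ (T.cover (S.s∈H k))) (proj₂ (S.cover (T.s∈H (e k))))))

    offset : Fin n → Σ Carrier (mem I)
    offset j = s (d j) ∙ t j ⁻¹ , ∼-sym I (proj₂ (S.cover (T.s∈H j)))

    reindexing : K ↔ Fin n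
    reindexing = mk↔ₛ′ e d e∘d d∘e

    reindexed : Fin n → Σ Carrier (mem I)
    reindexed j = offset j I/N.∙ Ψ.y j I/N.∙ offset (Ψ.σ j) I/N.⁻¹

    -- An equality in G, before passing to I/N. Both sides, followed by a representative, give s k ∙
    -- h: uniqueness first identifies the representatives (`σk≡`), which can then be cancelled.
    reindexed-≈ : ∀ k → proj₁ (Φ.y k) ≈ proj₁ (reindexed (e k))
    reindexed-≈ k = ∙-cancelʳ (s (Φ.σ k)) _ _ (begin
      proj₁ (Φ.y k) ∙ s (Φ.σ k)
        ≈⟨ Φ.factor k ⟨
      s k ∙ h
        ≈⟨ step ⟩
      proj₁ (reindexed (e k)) ∙ s (d (Ψ.σ (e k)))
        ≈⟨ ∙-congˡ (reflexive (≡.cong s σk≡)) ⟨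
      proj₁ (reindexed (e k)) ∙ s (Φ.σ k) ∎)
      where
      open SetoidReasoning setoid
      j = e k

      step : s k ∙ h ≈ proj₁ (reindexed j) ∙ s (d (Ψ.σ j))
      step = begin
        s k ∙ h
          ≈⟨ ∙-congʳ (reflexive (≡.cong s (d∘e k))) ⟨
        s (d j) ∙ h
          ≈⟨ solve (s (d j) ∷ t j ∷ h ∷ []) (var 0F ⊗ var 2F)
               (var 0F ⊗ var 1F ⁻ ⊗ (var 1F ⊗ var 2F)) ≡.refl ⟩
        s (d j) ∙ t j ⁻¹ ∙ (t j ∙ h)
          ≈⟨ ∙-congˡ (Ψ.factor j) ⟩
        s (d j) ∙ t j ⁻¹ ∙ (proj₁ (Ψ.y j) ∙ t (Ψ.σ j))
          ≈⟨ solve (s (d j) ∷ t j ∷ proj₁ (Ψ.y j) ∷ t (Ψ.σ j) ∷ s (d (Ψ.σ j)) ∷ [])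
               (var 0F ⊗ var 1F ⁻ ⊗ (var 2F ⊗ var 3F))
               (var 0F ⊗ var 1F ⁻ ⊗ var 2F ⊗ (var 4F ⊗ var 3F ⁻) ⁻ ⊗ var 4F) ≡.refl ⟩
        proj₁ (reindexed j) ∙ s (d (Ψ.σ j)) ∎

      σk≡ : Φ.σ k ≡ d (Ψ.σ j)
      σk≡ = S.factor-unique (proj₂ (Φ.y k)) (proj₂ (reindexed j))
              (trans (sym (Φ.factor k)) step)

  transversal-resp : ∀ {H H′ I I′ : Subgroup G} {K : Set} {s : K → Carrier} → H ≋ H′ → I ≋ I′ →
                     IsTransversal H I s → IsTransversal H′ I′ s
  transversal-resp e f S = record
    { s∈H    = λ k → _≋_.to e (s∈H k)
    ; cover  = λ h∈H′ → let k , h∼s = cover (_≋_.from e h∈H′) in k , _≋_.to f h∼s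
    ; unique = λ p → unique (_≋_.from f p)
    }
    where open IsTransversal S

  factorization-resp : ∀ {I I′ : Subgroup G} {K : Set} {s : K → Carrier} {h} → I ≤ I′ →
                       Factorization I s h → Factorization I′ s h
  factorization-resp I≤I′ Φ = record
    { σ = σ ; y = λ k → proj₁ (y k) , I≤I′ (proj₂ (y k)) ; factor = factor }
    where open Factorization Φ

  trivial-transversal : ∀ (H : Subgroup G) → IsTransversal H H {Fin 1} (λ _ → ε)
  trivial-transversal H = record
    { s∈H    = λ _ → Subgroup.ε-closed H
    ; cover  = λ h∈H → 0F , Subgroup.∙-closed H h∈H (Subgroup.⁻¹-closed H (Subgroup.ε-closed H))
    ; unique = λ { {0F} {0F} _ → ≡.refl }
    }

  module _ {I J : Subgroup G} {K L : Set} {t : K → Carrier} {u : L → Carrier} where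

    transversal-∘ : ∀ {H} → I ≤ H → J ≤ I → IsTransversal H I t → IsTransversal I J u →
                    IsTransversal H J {K × L} (λ (k , l) → u l ∙ t k)
    transversal-∘ {H} I≤H J≤I T U = record
      { s∈H    = λ (k , l) → Subgroup.∙-closed H (I≤H (U.s∈H l)) (T.s∈H k)
      ; cover  = λ {h} h∈H →
          let k , h∼t = T.cover h∈H
              l , a∼u = U.cover h∼t
          in (k , l) , ∼-trans J (∼-reflexive J (sym (//-rightDividesˡ (t k) h))) (∼-∙ʳ J (t k) a∼u)
      ; unique = unique
      }
      where
      module T = IsTransversal T
      module U = IsTransversal U

      unique : ∀ {p q : K × L} →
               u (proj₂ p) ∙ t (proj₁ p) ∼[ J ] u (proj₂ q) ∙ t (proj₁ q) → p ≡ q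
      -- Modulo I the elements u l and u l′ are absorbed, which gives k ≡ k′. Only then can t k be
      -- cancelled to compare u l and u l′ modulo J.
      unique {k , l} {k′ , l′} p with T.unique {k} {k′}
        (∼-trans I (∼-sym I (∼-∙ˡ I (t k) (U.s∈H l)))
                   (∼-trans I (J≤I p) (∼-∙ˡ I (t k′) (U.s∈H l′))))
      ... | ≡.refl = ≡.cong (k ,_) (U.unique (Subgroup.resp J
        (solve (u l ∷ u l′ ∷ t k ∷ []) (var 0F ⊗ var 2F ⊗ (var 1F ⊗ var 2F) ⁻)
               (var 0F ⊗ var 1F ⁻) ≡.refl) p))

    -- `Ψ k` factors the element y_k of I, not h. So the product of the new factors over l is the
    -- transfer of y_k to J, which is how the iterated transfer appears.
    factorization-∘ : ∀ {h} (Φ : Factorization I t h) →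
                      (∀ k → Factorization J u (proj₁ (Factorization.y Φ k))) →
                      Factorization J {K × L} (λ (k , l) → u l ∙ t k) h
    factorization-∘ {h} Φ Ψ = record
      { σ      = λ (k , l) → Φ.σ k , Ψ.σ k l
      ; y      = λ (k , l) → Ψ.y k l
      ; factor = λ (k , l) → begin
          u l ∙ t k ∙ h                                    ≈⟨ assoc _ _ _ ⟩
          u l ∙ (t k ∙ h)                                  ≈⟨ ∙-congˡ (Φ.factor k) ⟩
          u l ∙ (proj₁ (Φ.y k) ∙ t (Φ.σ k))                ≈⟨ assoc _ _ _ ⟨
          u l ∙ proj₁ (Φ.y k) ∙ t (Φ.σ k)                  ≈⟨ ∙-congʳ (Ψ.factor k l) ⟩
          proj₁ (Ψ.y k l) ∙ u (Ψ.σ k l) ∙ t (Φ.σ k)        ≈⟨ assoc _ _ _ ⟩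
          proj₁ (Ψ.y k l) ∙ (u (Ψ.σ k l) ∙ t (Φ.σ k))      ∎
      }
      where
      open SetoidReasoning setoid
      module Φ = Factorization Φ
      module Ψ k = Factorization (Ψ k)

  module _ (g : Carrier) {I : Subgroup G} {K : Set} {t : K → Carrier} where

    transversal-conj : ∀ {H} → IsTransversal H I t →
                       IsTransversal (conj g H) (conj g I) (λ k → g ∙ t k ∙ g ⁻¹)
    transversal-conj T = record
      { s∈H    = λ k → t k , s∈H k , refl
      ; cover  = λ (y , y∈H , h≈) → let k , y∼t = cover y∈H in
          k , y ∙ t k ⁻¹ , y∼t , trans (∙-congʳ h≈) (conj-// y (t k))
      ; unique = λ {k} {l} (z , z∈I , e) → unique (Subgroup.resp I
          (conj-injective (trans (sym e) (conj-// (t k) (t l)))) z∈I)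
      }
      where
      open IsTransversal T

      conj-// : ∀ x y → g ∙ x ∙ g ⁻¹ ∙ (g ∙ y ∙ g ⁻¹) ⁻¹ ≈ g ∙ (x ∙ y ⁻¹) ∙ g ⁻¹
      conj-// x y = solve (g ∷ x ∷ y ∷ [])
        (var 0F ⊗ var 1F ⊗ var 0F ⁻ ⊗ (var 0F ⊗ var 2F ⊗ var 0F ⁻) ⁻)
        (var 0F ⊗ (var 1F ⊗ var 2F ⁻) ⊗ var 0F ⁻) ≡.refl

      conj-injective : ∀ {x y} → g ∙ x ∙ g ⁻¹ ≈ g ∙ y ∙ g ⁻¹ → x ≈ y
      conj-injective e = ∙-cancelˡ g _ _ (∙-cancelʳ (g ⁻¹) _ _ e)

    factorization-conj : ∀ {h} → Factorization I t h →
                         Factorization (conj g I) (λ k → g ∙ t k ∙ g ⁻¹) (g ∙ h ∙ g ⁻¹)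
    factorization-conj {h} Φ = record
      { σ      = σ
      ; y      = λ k → g ∙ proj₁ (y k) ∙ g ⁻¹ , proj₁ (y k) , proj₂ (y k) , refl
      ; factor = λ k → trans (conj-∙′ (t k) h)
                         (trans (∙-congʳ (∙-congˡ (factor k))) (sym (conj-∙′ (proj₁ (y k)) (t (σ k)))))
      }
      where
      open Factorization Φ

      conj-∙′ : ∀ x y → g ∙ x ∙ g ⁻¹ ∙ (g ∙ y ∙ g ⁻¹) ≈ g ∙ (x ∙ y) ∙ g ⁻¹
      conj-∙′ x y = solve (g ∷ x ∷ y ∷ [])
        (var 0F ⊗ var 1F ⊗ var 0F ⁻ ⊗ (var 0F ⊗ var 2F ⊗ var 0F ⁻))
        (var 0F ⊗ (var 1F ⊗ var 2F) ⊗ var 0F ⁻) ≡.refl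

  -- H = ⨆ₖ I rₖ J and J = ⨆ₗ (I^{rₖ} ∩ J) sₖₗ give H = ⨆ₖₗ I rₖ sₖₗ.
  module _ {H I J : Subgroup G} (J≤H : J ≤ H) (D : DoubleCosetReps I H J) where

    private
      module D = DoubleCosetReps D
      module I = Subgroup I

    double-coset-transversal :
      (S : ∀ k → RightTransversal J (conj⁻ (D.rep k) I ⊓ J)) →
      IsTransversal H I {Σ (Fin D.n) (λ k → Fin (RightTransversal.n (S k)))}
        (λ (k , l) → D.rep k ∙ RightTransversal.t (S k) l)
    double-coset-transversal S = record
      { s∈H    = λ (k , l) → Subgroup.∙-closed H (D.rep∈H k) (J≤H (S.t∈H k l))
      ; cover  = cover
      ; unique = unique
      }
      where
      module S k = RightTransversal (S k)

      cover : ∀ {h} → h ∈ mem H →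
              Σ[ (k , l) ∈ Σ (Fin D.n) (Fin ∘ S.n) ] h ∼[ I ] D.rep k ∙ S.t k l
      cover {h} h∈H =
        -- From h = a r b and b s⁻¹ = r⁻¹ c r it follows that h = (a c)(r s), with a c in I.
        let k , a , b , a∈I , b∈J , h≈ = D.cover h∈H
            l , (c , c∈I , bs⁻¹≈) , _ = S.cover k b∈J
        in (k , l) , I.resp (eq (D.rep k) (S.t k l) h≈ bs⁻¹≈) (I.∙-closed a∈I c∈I)
        where
        open SetoidReasoning setoid

        eq : ∀ {a b c} r s → h ≈ a ∙ r ∙ b → b ∙ s ⁻¹ ≈ r ⁻¹ ∙ c ∙ r ⁻¹ ⁻¹ →
             a ∙ c ≈ h ∙ (r ∙ s) ⁻¹
        eq {a} {b} {c} r s h≈ bs⁻¹≈ = begin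
          a ∙ c
            ≈⟨ solve (a ∷ c ∷ r ∷ []) (var 0F ⊗ var 1F)
                 (var 0F ⊗ var 2F ⊗ (var 2F ⁻ ⊗ var 1F ⊗ var 2F ⁻ ⁻) ⊗ var 2F ⁻) ≡.refl ⟩
          a ∙ r ∙ (r ⁻¹ ∙ c ∙ r ⁻¹ ⁻¹) ∙ r ⁻¹
            ≈⟨ ∙-congʳ (∙-congˡ bs⁻¹≈) ⟨
          a ∙ r ∙ (b ∙ s ⁻¹) ∙ r ⁻¹
            ≈⟨ solve (a ∷ b ∷ r ∷ s ∷ []) (var 0F ⊗ var 2F ⊗ (var 1F ⊗ var 3F ⁻) ⊗ var 2F ⁻)
                 (var 0F ⊗ var 2F ⊗ var 1F ⊗ (var 2F ⊗ var 3F) ⁻) ≡.refl ⟩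
          a ∙ r ∙ b ∙ (r ∙ s) ⁻¹
            ≈⟨ ∙-congʳ h≈ ⟨
          h ∙ (r ∙ s) ⁻¹ ∎

      unique : ∀ {p q : Σ (Fin D.n) (Fin ∘ S.n)} →
               D.rep (proj₁ p) ∙ S.t (proj₁ p) (proj₂ p) ∼[ I ]
               D.rep (proj₁ q) ∙ S.t (proj₁ q) (proj₂ q) → p ≡ q
      -- r_k s_{kl} lies in both I r_k J and I r_{k′} J, so k ≡ k′. Conjugating the congruence by
      -- r_k⁻¹ then puts s_{kl} s_{kl′}⁻¹ into the intersection of J with the conjugate of I.
      unique {k , l} {k′ , l′} p with D.unique {k = k} {k′}
        (Subgroup.∙-closed H (D.rep∈H k) (J≤H (S.t∈H k l)))
        (ε , S.t k l , I.ε-closed , S.t∈H k l , ∙-congʳ (sym (identityˡ _)))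
        (_ , S.t k′ l′ , p , S.t∈H k′ l′ ,
          solve (D.rep k ∙ S.t k l ∷ D.rep k′ ∷ S.t k′ l′ ∷ []) (var 0F)
            (var 0F ⊗ (var 1F ⊗ var 2F) ⁻ ⊗ var 1F ⊗ var 2F) ≡.refl)
      ... | ≡.refl = ≡.cong (k ,_) (IsTransversal.unique (isTransversal (S k))
        ( (_ , p ,
           solve (D.rep k ∷ S.t k l ∷ S.t k l′ ∷ []) (var 1F ⊗ var 2F ⁻)
             (var 0F ⁻ ⊗ (var 0F ⊗ var 1F ⊗ (var 0F ⊗ var 2F) ⁻) ⊗ var 0F ⁻ ⁻) ≡.refl)
        , Subgroup.∙-closed J (S.t∈H k l) (Subgroup.⁻¹-closed J (S.t∈H k l′))))

  -- Within H the coset of t_j is what remains outside the finitely many other cosets, each a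
  -- translate of the closed set I. As closedness speaks of complements, `cover` is what turns
  -- avoiding the other cosets into membership in this one.
  coset-open : ∀ {H I} → IsClosed rawSpace (mem I) → (T : RightTransversal H I) → ∀ j →
               Σ[ O ∈ Pred Carrier ℓ ] IsOpen O ×
                 (∀ {x} → x ∈ mem H → x ∼[ I ] RightTransversal.t T j → x ∈ O) ×
                 (∀ {x} → x ∈ mem H → x ∈ O → x ∼[ I ] RightTransversal.t T j)
  coset-open {H} {I} I-closed T j =
    (λ x → ∀ k → k ≢ j → ¬ (x ∼[ I ] t k)) ,
    open-⋂ (λ k x → k ≢ j → ¬ (x ∼[ I ] t k)) excluded ,
    (λ x∈H x∼tj k k≢j x∼tk → k≢j (unique x∈H x∼tk x∼tj)) ,
    coset
    where
    open RightTransversal T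

    excluded : ∀ k → IsOpen (λ x → k ≢ j → ¬ (x ∼[ I ] t k))
    excluded k with k Fin.≟ j
    ... | yes k≡j = open-resp-≐ ((λ _ k≢j → ⊥-elim (k≢j k≡j)) , λ _ → tt) open-whole
    ... | no k≢j  = open-resp-≐ ((λ p _ → p) , λ p → p k≢j)
                      (product-continuous id (const-continuous (t k ⁻¹)) I-closed)

    coset : ∀ {x} → x ∈ mem H → (∀ k → k ≢ j → ¬ (x ∼[ I ] t k)) → x ∼[ I ] t j
    coset x∈H x∉ with cover x∈H
    ... | k , x∼tk with k Fin.≟ j
    ...   | yes ≡.refl = x∼tk
    ...   | no k≢j     = ⊥-elim (x∉ k k≢j x∼tk)

  -- Transfer

  open IsAbelianQuotient using (abelianGroup; isTopologicalAbelianGroup)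

  -- Open sets of I/N are cut out by open sets of G, so continuity of the transfer is tested on the
  -- product formed in G.
  proj₁-sum : ∀ (I N : Subgroup G) {n} (x : Fin n → Σ Carrier (mem I)) →
              proj₁ (sum (RawTopologicalGroup.rawMonoid (quotientRaw I N)) x) ≡
              sum rawMonoid (proj₁ ∘ x)
  proj₁-sum I N {zero}  x = ≡.refl
  proj₁-sum I N {suc n} x = ≡.cong (proj₁ (x zero) ∙_) (proj₁-sum I N (x ∘ suc))

  module _ {H I N : Subgroup G} (Q : IsAbelianQuotient I N) (T : RightTransversal H I) where

    open RightTransversal T using (t; t∈H)
    private
      module H = Subgroup H
      module H/1 = RawTopologicalGroup (subgroupRaw H)
      A = abelianGroup Q
      module A = AbelianGroup A
      module ∑ = Sum A.commutativeMonoid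

    -- Up to reindexing, the two families of factors differ by the coboundary of `offset`.
    transfer-Fin : ∀ (h : H/1.Carrier) {m} {s : Fin m → Carrier} → IsTransversal H I s →
                   (Φ : Factorization I s (proj₁ h)) →
                   transfer T N h A.≈ ∑.sum (Factorization.y Φ)
    transfer-Fin h S Φ =
      sum-cohomologous A (offset N S Φ T′ Ψ) (Factorization.y Ψ) (σ-bijective T′ (proj₂ h) Ψ)
        (reindexing N S Φ T′ Ψ) (Factorization.y Φ)
        (λ k → ∼-reflexive N (reindexed-≈ N S Φ T′ Ψ k))
      where
      T′ = isTransversal T
      Ψ  = κ-factorization T h

    transfer-Σ : ∀ (h : H/1.Carrier) {m} {c : Fin m → ℕ} {s : Σ (Fin m) (Fin ∘ c) → Carrier} →
                 IsTransversal H I s → (Φ : Factorization I s (proj₁ h)) →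
                 transfer T N h A.≈ ∑.sum (λ k → ∑.sum (λ l → Factorization.y Φ (k , l)))
    transfer-Σ h S Φ =
      sum-cohomologous-Σ A (offset N S Φ T′ Ψ) (Factorization.y Ψ) (σ-bijective T′ (proj₂ h) Ψ)
        (reindexing N S Φ T′ Ψ) (Factorization.y Φ)
        (λ k → ∼-reflexive N (reindexed-≈ N S Φ T′ Ψ k))
      where
      T′ = isTransversal T
      Ψ  = κ-factorization T h

    -- The representative returned by `cover` may depend on the membership proof and on the
    -- presentation of the element, so the factors need not agree one by one. Instead the
    -- factorization of y is reused as one of x.
    transfer-cong : ∀ {x y : H/1.Carrier} → proj₁ x ≈ proj₁ y → transfer T N x A.≈ transfer T N y
    transfer-cong {x} {y} x≈y = transfer-Fin x (isTransversal T) record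
      { σ      = σ
      ; y      = κ′
      ; factor = λ k → trans (∙-congˡ x≈y) (factor k)
      }
      where open Factorization (κ-factorization T y) renaming (y to κ′)

    transfer-homo : ∀ x y → transfer T N (x H/1.∙ y) A.≈ transfer T N x A.∙ transfer T N y
    transfer-homo x y = begin
      transfer T N (x H/1.∙ y)
        ≈⟨ transfer-Fin (x H/1.∙ y) T′ (factorization-∙ X Y) ⟩
      ∑.sum (λ k → Factorization.y X k A.∙ Factorization.y Y (Factorization.σ X k))
        ≈⟨ sum-∙-permute A (Factorization.y X) (Factorization.y Y) (σ-bijective T′ (proj₂ x) X) ⟩
      transfer T N x A.∙ transfer T N y ∎
      where
      open SetoidReasoning A.setoid
      T′ = isTransversal T
      X  = κ-factorization T x
      Y  = κ-factorization T y

    -- Near x, the transfer is y ↦ ∏ tₖ y t_{σ(k)}⁻¹ with the permutation σ of x,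
    -- because the cosets of I are open in H.
    transfer-continuous : IsClosed rawSpace (mem I) →
                          ∀ {U} → RawTopologicalGroup.IsOpen (quotientRaw I N) U →
                          H/1.IsOpen (U ∘ transfer T N)
    transfer-continuous I-closed {U} (U-resp , W , W-open , U⊆W , W⊆U) =
      (λ y → Σ[ x ∈ Σ H/1.Carrier (U ∘ transfer T N) ] y ∈ nbhd (proj₁ x)) ,
      open-⋃ (λ x → nbhd-open (proj₁ x)) ,
      (λ {x} u → (x , u) , (λ k → proj₁ (proj₂ (proj₂ (coset (σ x k))))
                                    (H.∙-closed (t∈H k) (proj₂ x))
                                    (proj₂ (RightTransversal.cover T (H.∙-closed (t∈H k) (proj₂ x))))) ,
                 open-resp-≈ W-open (local x x (λ _ → ≡.refl)) (U⊆W u)) ,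
      -- Since t_k y lies in the open set cutting out the coset of t_k x, σ y = σ x, and `∏ x` at y
      -- is the transfer of y itself.
      (λ {y} ((x , _) , y∈coset , w) → W⊆U (open-resp-≈ W-open
        (sym (local x y λ k → RightTransversal.unique T (H.∙-closed (t∈H k) (proj₂ y))
               (proj₂ (RightTransversal.cover T (H.∙-closed (t∈H k) (proj₂ y))))
               (proj₂ (proj₂ (proj₂ (coset (σ x k)))) (H.∙-closed (t∈H k) (proj₂ y)) (y∈coset k))))
        w))
      where
      σ : H/1.Carrier → _
      σ x = Factorization.σ (κ-factorization T x)

      coset = coset-open I-closed T

      ∏ : H/1.Carrier → Carrier → Carrier
      ∏ x y = sum rawMonoid λ k → t k ∙ y ∙ t (σ x k) ⁻¹

      nbhd : H/1.Carrier → Pred Carrier ℓ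
      nbhd x y = (∀ k → (t k ∙ y) ∈ proj₁ (coset (σ x k))) × ∏ x y ∈ W

      nbhd-open : ∀ x → IsOpen (nbhd x)
      nbhd-open x = open-∩
        (open-⋂ (λ k y → (t k ∙ y) ∈ proj₁ (coset (σ x k))) λ k →
          product-continuous (const-continuous (t k)) id (proj₁ (proj₂ (coset (σ x k)))))
        (sum-continuous (λ k → sandwich-continuous (t k) (t (σ x k) ⁻¹)) W-open)

      local : ∀ x y → (∀ k → σ y k ≡ σ x k) → proj₁ (transfer T N y) ≈ ∏ x (proj₁ y)
      local x y σy≗σx = trans (reflexive (proj₁-sum I N (Factorization.y (κ-factorization T y))))
        (reflexive (Sum′.sum-cong-≗ λ k → ≡.cong (λ l → t k ∙ proj₁ y ∙ t l ⁻¹) (σy≗σx k)))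
        where module Sum′ = MonoidSum (Group.monoid group)

  -- The functor π_R

  module _ {m : Level} {M : MackeySystem G m} {F : IsRFinite M} (A : AbelianizationSystem M F) where

    open MackeySystem M
    open IsRFinite F
    open AbelianizationSystem A
    open RawMackeyFunctor (πR A) using (∣_∣; cast; res; ind; con)

    quotient : ∀ H → IsAbelianQuotient ⌊ H ⌋ (R H)
    quotient H = record { sub = R-sub H ; normal = R-normal H ; comm = R-abelian H }

    private
      module π/ (H : Obj) = AbelianGroup (abelianGroup (quotient H))
      module ∑ (H : Obj) = Sum (π/.commutativeMonoid H)

    cast-homomorphism : ∀ {H K} (e : ⌊ H ⌋ ≋ ⌊ K ⌋) →
                        IsContinuousHomomorphism (π H) (π K) (cast {H} {K} e)
    cast-homomorphism {H} {K} e =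
      inclusion-homomorphism ⌊ H ⌋ ⌊ K ⌋ (R H) (R K) (_≋_.to e) (_≋_.to (R-resp e))

    ind-homomorphism : ∀ {H I} (q : 𝔐 Kind.i H I) → IsContinuousHomomorphism (π I) (π H) (ind q)
    ind-homomorphism {H} {I} q =
      inclusion-homomorphism ⌊ I ⌋ ⌊ H ⌋ (R I) (R H) (𝔐-sub q) (R-ind q)

    con-homomorphism : ∀ g H → IsContinuousHomomorphism (π H) (π (g · H)) (con g H)
    con-homomorphism g H =
      conjugation-homomorphism ⌊ H ⌋ ⌊ g · H ⌋ (R H) (R (g · H)) g (con g H) (λ _ → refl)
        (λ {x} x∈R → _≋_.from (R-conj g H) (x , x∈R , refl))

    res-homo : ∀ {H I} (p : 𝔐 Kind.r H I) x y →
               π/._≈_ I (res p (π/._∙_ H x y)) (π/._∙_ I (res p x) (res p y))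
    res-homo {H} {I} p = transfer-homo (quotient I) (transversal p)

    -- `R-ker` only speaks of elements of R(H), so x is written as z y with z = x y⁻¹ in R(H), and
    -- multiplicativity removes z.
    res-cong : ∀ {H I} (p : 𝔐 Kind.r H I) {x y} → π/._≈_ H x y → π/._≈_ I (res p x) (res p y)
    res-cong {H} {I} p {x} {y} x∼y = begin
      res p x                     ≈⟨ transfer-cong (quotient I) (transversal p) {x} {z H.∙ y}
                                       (sym (//-rightDividesˡ (proj₁ y) (proj₁ x))) ⟩
      res p (z H.∙ y)             ≈⟨ res-homo p z y ⟩
      res p z I.∙ res p y         ≈⟨ I.∙-congʳ {res p y} {res p z} {I.ε} (R-ker p x∼y) ⟩
      I.ε I.∙ res p y             ≈⟨ I.identityˡ (res p y) ⟩
      res p y                     ∎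
      where
      module H = π/ H
      module I = π/ I
      open SetoidReasoning I.setoid
      z : ∣ H ∣
      z = proj₁ x ∙ proj₁ y ⁻¹ , R-sub H x∼y

    res-homomorphism : ∀ {H I} (p : 𝔐 Kind.r H I) → IsContinuousHomomorphism (π H) (π I) (res p)
    res-homomorphism {H} {I} p = record
      { isGroupHomomorphism = homo⇒isGroupHomomorphism (π/.group H) (π/.group I)
          (λ {x} {y} → res-cong p {x} {y}) (res-homo p)
      ; continuous = λ U-open →
          (λ {x} {y} x∼y → proj₁ U-open (res-cong p {x} {y} x∼y)) ,
          transfer-continuous (quotient I) (transversal p) (closed I) U-open
      }

    sum-map : ∀ {H K} {f : ∣ H ∣ → ∣ K ∣} → IsContinuousHomomorphism (π H) (π K) f →
              ∀ {n} (x : Fin n → ∣ H ∣) → π/._≈_ K (f (∑.sum H x)) (∑.sum K (f ∘ x))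
    sum-map {H} {K} {f} f-homo = sum-homo (π/.rawMonoid H) (π/.monoid K)
      (GroupMorphisms.IsGroupHomomorphism.isMonoidHomomorphism
        (IsContinuousHomomorphism.isGroupHomomorphism f-homo))

    private
      κ : ∀ {H I} (p : 𝔐 Kind.r H I) (x : ∣ H ∣) → Fin (index p) → ∣ I ∣
      κ p x = Factorization.y (κ-factorization (transversal p) x)

    -- `transversal p` and `transversal p′` are unrelated choices even when the subgroups agree. The
    -- first is carried over to H′ and I′ with its factors unchanged.
    cast-res : ∀ {H H′ I I′} (e : ⌊ H ⌋ ≋ ⌊ H′ ⌋) (f : ⌊ I ⌋ ≋ ⌊ I′ ⌋)
               (p : 𝔐 Kind.r H I) (p′ : 𝔐 Kind.r H′ I′) x →
               π/._≈_ I′ (cast {I} {I′} f (res p x)) (res p′ (cast {H} {H′} e x))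
    cast-res {H} {H′} {I} {I′} e f p p′ x = begin
      castI (res p x)
        ≈⟨ sum-map {I} {I′} (cast-homomorphism f) (κ p x) ⟩
      ∑.sum I′ (castI ∘ κ p x)
        ≈⟨ transfer-Fin (quotient I′) (transversal p′) (castH x)
             (transversal-resp e f (isTransversal (transversal p)))
             (factorization-resp (_≋_.to f) (κ-factorization (transversal p) x)) ⟨
      res p′ (castH x) ∎
      where
      open SetoidReasoning (π/.setoid I′)
      castH = cast {H} {H′} e
      castI = cast {I} {I′} f

    -- The chosen representative of H in H may be any element of H. Against ε the single factor is
    -- x, and the sum over `Fin 1` is x ∙ ε.
    res-id : ∀ {H} (p : 𝔐 Kind.r H H) x → π/._≈_ H (res p x) x
    res-id {H} p x = begin
      res p x      ≈⟨ transfer-Fin (quotient H) (transversal p) x (trivial-transversal ⌊ H ⌋)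
                        record { σ = id ; y = λ _ → x
                               ; factor = λ _ → trans (identityˡ _) (sym (identityʳ _)) } ⟩
      x H.∙ H.ε    ≈⟨ H.identityʳ x ⟩
      x            ∎
      where
      module H = π/ H
      open SetoidReasoning H.setoid

    res-res : ∀ {H I J} (p : 𝔐 Kind.r H I) (p′ : 𝔐 Kind.r I J) x →
              π/._≈_ J (res p′ (res p x)) (res (𝔐-trans p p′) x)
    res-res {H} {I} {J} p p′ x = begin
      res p′ (res p x)
        ≈⟨ sum-map {I} {J} (res-homomorphism p′) (κ p x) ⟩
      ∑.sum J (res p′ ∘ κ p x)
        ≈⟨ transfer-Σ (quotient J) (transversal (𝔐-trans p p′)) x
             (transversal-∘ (𝔐-sub p) (𝔐-sub p′)
               (isTransversal (transversal p)) (isTransversal (transversal p′)))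
             (factorization-∘ (κ-factorization (transversal p) x)
               (λ k → κ-factorization (transversal p′) (κ p x k))) ⟨
      res (𝔐-trans p p′) x ∎
      where open SetoidReasoning (π/.setoid J)

    con-res : ∀ {g H I} (p : 𝔐 Kind.r H I) x →
              π/._≈_ (g · I) (con g I (res p x)) (res (𝔐-conj g p) (con g H x))
    con-res {g} {H} {I} p x = begin
      con g I (res p x)
        ≈⟨ sum-map {I} {g · I} (con-homomorphism g I) (κ p x) ⟩
      ∑.sum (g · I) (con g I ∘ κ p x)
        ≈⟨ transfer-Fin (quotient (g · I)) (transversal (𝔐-conj g p)) (con g H x)
             (transversal-conj g (isTransversal (transversal p)))
             (factorization-conj g (κ-factorization (transversal p) x)) ⟨
      res (𝔐-conj g p) (con g H x) ∎
      where open SetoidReasoning (π/.setoid (g · I))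

    -- The Mackey formula

    module _ {H I J} (p : 𝔐 Kind.r H I) (q : 𝔐 Kind.i H J)
             (D : DoubleCosetReps ⌊ I ⌋ ⌊ H ⌋ ⌊ J ⌋) where

      private
        module D = DoubleCosetReps D
        module DC k = DoubleCoset p q (D.rep∈H k)

        S : ∀ k → RightTransversal ⌊ J ⌋ ⌊ DC.Iʰ∩J k ⌋
        S k = transversal (DC.Iʰ∩J∈𝔐r k)

        ind-con : ∀ k → ∣ DC.Iʰ∩J k ∣ → ∣ I ∣
        ind-con k z = ind (DC.I∩ʰJ∈𝔐i k)
          (cast {D.rep k · DC.Iʰ∩J k} {DC.I∩ʰJ k} (conj-⊓ {I = ⌊ I ⌋} {⌊ J ⌋})
            (con (D.rep k) (DC.Iʰ∩J k) z))

        -- The composite is conjugation by r = `D.rep k`. It descends because r R(Iʳ ∩ J) r⁻¹ = R(I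
        -- ∩ ʳJ) lies in R(I), by `R-conj`, `R-resp` and `R-ind`.
        ind-con-homomorphism : ∀ k → IsContinuousHomomorphism (π (DC.Iʰ∩J k)) (π I) (ind-con k)
        ind-con-homomorphism k =
          conjugation-homomorphism ⌊ DC.Iʰ∩J k ⌋ ⌊ I ⌋ (R (DC.Iʰ∩J k)) (R I) (D.rep k) (ind-con k)
            (λ _ → refl)
            (λ {x} x∈R → R-ind (DC.I∩ʰJ∈𝔐i k)
              (_≋_.to (R-resp {D.rep k · DC.Iʰ∩J k} {DC.I∩ʰJ k} (conj-⊓ {I = ⌊ I ⌋} {⌊ J ⌋}))
                (_≋_.from (R-conj (D.rep k) (DC.Iʰ∩J k)) (x , x∈R , refl))))

        -- As x lies in J, right multiplication by x preserves each I r_k J, so σ fixes k. Inside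
        -- the block, s_l x = y s_{l′} becomes r s_l x = (r y r⁻¹) r s_{l′}, and r y r⁻¹ is
        -- `ind-con k` of y.
        Φ : ∀ (x : ∣ J ∣) → Factorization ⌊ I ⌋ {Σ (Fin D.n) (λ k → Fin (RightTransversal.n (S k)))}
                     (λ (k , l) → D.rep k ∙ RightTransversal.t (S k) l) (proj₁ x)
        Φ x = record
          { σ      = λ (k , l) → k , Ψ.σ k l
          ; y      = λ (k , l) → ind-con k (Ψ.y k l)
          ; factor = λ (k , l) → let r = D.rep k ; s = RightTransversal.t (S k) in begin
              r ∙ s l ∙ proj₁ x
                ≈⟨ assoc _ _ _ ⟩
              r ∙ (s l ∙ proj₁ x)
                ≈⟨ ∙-congˡ (Ψ.factor k l) ⟩
              r ∙ (proj₁ (Ψ.y k l) ∙ s (Ψ.σ k l))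
                ≈⟨ solve (r ∷ proj₁ (Ψ.y k l) ∷ s (Ψ.σ k l) ∷ []) (var 0F ⊗ (var 1F ⊗ var 2F))
                     (var 0F ⊗ var 1F ⊗ var 0F ⁻ ⊗ (var 0F ⊗ var 2F)) ≡.refl ⟩
              r ∙ proj₁ (Ψ.y k l) ∙ r ⁻¹ ∙ (r ∙ s (Ψ.σ k l)) ∎
          }
          where
          open SetoidReasoning setoid
          module Ψ k = Factorization (κ-factorization (S k) x)

      mackey-formula : ∀ x → π/._≈_ I (res p (ind q x))
                         (∑.sum I (λ k → ind-con k (res (DC.Iʰ∩J∈𝔐r k) x)))
      mackey-formula x = begin
        res p (ind q x)
          ≈⟨ transfer-Σ (quotient I) (transversal p) (ind q x)
               (double-coset-transversal (𝔐-sub q) D S) (Φ x) ⟩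
        ∑.sum I (λ k → ∑.sum I (ind-con k ∘ κ (DC.Iʰ∩J∈𝔐r k) x))
          ≈⟨ ∑.sum-cong-≋ I
               {x = λ k → ind-con k (res (DC.Iʰ∩J∈𝔐r k) x)}
               {y = λ k → ∑.sum I (ind-con k ∘ κ (DC.Iʰ∩J∈𝔐r k) x)}
               (λ k → sum-map {DC.Iʰ∩J k} {I} (ind-con-homomorphism k) (κ (DC.Iʰ∩J∈𝔐r k) x)) ⟨
        ∑.sum I (λ k → ind-con k (res (DC.Iʰ∩J∈𝔐r k) x)) ∎
        where open SetoidReasoning (π/.setoid I)

    πR-isMackeyFunctor : IsMackeyFunctor M (πR A)
    πR-isMackeyFunctor = record
      { obj-TAb    = λ H → isTopologicalAbelianGroup (quotient H)
      ; cast-TAb   = cast-homomorphism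
      ; res-TAb    = res-homomorphism
      ; ind-TAb    = ind-homomorphism
      ; con-TAb    = con-homomorphism
      -- Apart from `con-id`, the identities without `res` hold between underlying elements of G,
      -- whence `∼-reflexive`.
      ; cast-id    = λ {H} _ _ → ∼-reflexive (R H) refl
      ; cast-trans = λ {_} {_} {L} _ _ _ → ∼-reflexive (R L) refl
      ; cast-res   = cast-res
      ; cast-ind   = λ {_} {H′} _ _ _ _ _ → ∼-reflexive (R H′) refl
      ; cast-con   = λ {_} {g′} {_} {H′} d _ _ →
          ∼-reflexive (R (g′ · H′)) (∙-cong (∙-congʳ d) (⁻¹-cong d))
      ; res-id     = res-id
      ; ind-id     = λ {H} _ _ → ∼-reflexive (R H) refl
      ; con-id     = con-id
      ; res-res    = res-res
      ; ind-ind    = λ {H} _ _ _ → ∼-reflexive (R H) refl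
      ; con-con    = λ {g′} {g} {H} x → ∼-reflexive (R ((g′ ∙ g) · H))
          (solve (g′ ∷ g ∷ proj₁ x ∷ [])
            (var 0F ⊗ (var 1F ⊗ var 2F ⊗ var 1F ⁻) ⊗ var 0F ⁻)
            (var 0F ⊗ var 1F ⊗ var 2F ⊗ (var 0F ⊗ var 1F) ⁻) ≡.refl)
      ; con-res    = con-res
      ; con-ind    = λ {g} {H} _ _ → ∼-reflexive (R (g · H)) refl
      ; mackey     = mackey-formula
      }
      where
      -- Conjugation by h is an inner automorphism of H, hence trivial on the abelian quotient.
      con-id : ∀ {H h} (h∈H : h ∈ mem ⌊ H ⌋) x →
               π/._≈_ H (cast {h · H} {H} (conj-self h∈H) (con h H x)) x
      con-id {H} {h} h∈H x = begin
        cast {h · H} {H} (conj-self h∈H) (con h H x)  ≈⟨ ∼-reflexive (R H) refl ⟩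
        h′ H.∙ x H.∙ h′ H.⁻¹  ≈⟨ H.∙-congʳ {h′ H.⁻¹} {h′ H.∙ x} {x H.∙ h′} (H.comm h′ x) ⟩
        x H.∙ h′ H.∙ h′ H.⁻¹  ≈⟨ GroupProperties.//-rightDividesʳ H.group h′ x ⟩
        x                     ∎
        where
        module H = π/ H
        open SetoidReasoning H.setoid
        h′ : ∣ H ∣
        h′ = h , h∈H

    πR-isCohomological : IsCohomological M F (πR A)
    πR-isCohomological = record { ind-res = ind-res }
      where
      ind-res : ∀ {H I} (p : 𝔐 Kind.r H I) (q : 𝔐 Kind.i H I) x →
                π/._≈_ H (ind q (res p x)) (_times_ (π/.rawMonoid H) (index p) x)
      ind-res {H} {I} p q x = begin
        ind q (res p x)
          ≈⟨ sum-map {I} {H} (ind-homomorphism q) (κ p x) ⟩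
        ∑.sum H (ind q ∘ κ p x)
          ≈⟨ ∑.sum-cong-≋ H {x = ind q ∘ κ p x} {y = txt⁻¹} (λ _ → ∼-reflexive (R H) refl) ⟩
        ∑.sum H txt⁻¹
          -- The t_k need not lie in I, but they lie in H. After `ind` each factor is therefore the
          -- constant x twisted by the coboundary of t.
          ≈⟨ sum-coboundary (abelianGroup (quotient H)) t (λ _ → x) σ ⟩
        ∑.sum H {index p} (λ _ → x)
          ≈⟨ ∑.sum-replicate H (index p) {x} ⟩
        _times_ (π/.rawMonoid H) (index p) x ∎
        where
        module H = π/ H
        open SetoidReasoning H.setoid
        T = transversal p
        σ = σ-bijective (isTransversal T) (proj₂ x) (κ-factorization T x)

        t txt⁻¹ : Fin (index p) → ∣ H ∣
        t k     = RightTransversal.t T k , RightTransversal.t∈H T k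
        txt⁻¹ k = t k H.∙ x H.∙ t (Inverse.to σ k) H.⁻¹

proposition2p4p9 : {ℓ m : Level} (G : TopologicalGroup ℓ) (M : MackeySystem G m)
    (F : IsRFinite M) (A : AbelianizationSystem M F) →
    IsMackeyFunctor M (πR A) × IsCohomological M F (πR A)
proposition2p4p9 G M F A = πR-isMackeyFunctor A , πR-isCohomological A
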